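{- (i) For every integer $k\geq 1$ there exists a finite simple graph with minimum degree $3k-3$ that has no $(k+1)$-connected subgraph on more than $\lceil \tfrac{4}{3}k\rceil$ vertices. (ii) There is a constant $c$ such that for every integer $k\geq 1$ there exists a finite simple graph with minimum degree at least $\big(3-\tfrac{1}{6}\big)k-c$ that has no $(k+1)$-connected subgraph.
   Context: A graph is $(k+1)$-connected if it has more than $k+1$ vertices and remains connected after deleting any set of at most $k$ vertices. -}

module Defs where

open import Data.Nat using (ℕ; zero; suc; _+_; _*_; _∸_; _≤_; _<_; _/_)
open import Data.Fin using (Fin)
open import Data.Fin.Subset using (Subset; _∈_; _─_; ∣_∣)
open import Data.Bool using (Bool; true; false)
open import Data.Vec using (tabulate)
open import Data.Product using (Σ; _×_; ∃)
open import Relation.Binary.PropositionalEquality using (_≡_)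

record Graph : Set where
  field
    n      : ℕ
    adj    : Fin n → Fin n → Bool
    sym    : ∀ u v → adj u v ≡ adj v u
    irrefl : ∀ v → adj v v ≡ false
open Graph public

nbhd : (G : Graph) → Fin (n G) → Subset (n G)
nbhd G v = tabulate (adj G v)

deg : (G : Graph) → Fin (n G) → ℕ
deg G v = ∣ nbhd G v ∣

MinDegreeEq : Graph → ℕ → Set
MinDegreeEq G d = (∀ v → d ≤ deg G v) × ∃ (λ v → deg G v ≡ d)

record Subgraph (G : Graph) : Set where
  field
    S      : Subset (n G)
    E      : Fin (n G) → Fin (n G) → Bool
    E-sym  : ∀ u v → E u v ≡ E v u
    E⊆adj  : ∀ u v → E u v ≡ true → adj G u v ≡ true
    E⊆S    : ∀ u v → E u v ≡ true → (u ∈ S) × (v ∈ S)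
open Subgraph public

data Walk {m : ℕ} (W : Subset m) (E : Fin m → Fin m → Bool) : Fin m → Fin m → Set where
  here  : ∀ {u} → u ∈ W → Walk W E u u
  step  : ∀ {u w v} → u ∈ W → E u w ≡ true → Walk W E w v → Walk W E u v

-- the graph (W, E restricted to W) is connected
-- (nonemptiness is automatic below since more than k+1 vertices remain before deletion)
Connected : {m : ℕ} → Subset m → (Fin m → Fin m → Bool) → Set
Connected W E = ∀ u v → u ∈ W → v ∈ W → Walk W E u v

KConn : {G : Graph} → ℕ → Subgraph G → Set
KConn {G} k H =
  (suc k < ∣ S H ∣) ×
  (∀ (X : Subset (n G)) → ∣ X ∣ ≤ k → Connected (S H ─ X) (E H))

ceil4k/3 : ℕ → ℕ
ceil4k/3 k = (4 * k + 2) / 3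

{-# OPTIONS --safe #-}
-- A separator of at most k vertices confines every (k+1)-connected subgraph to one side.
-- Build a tower of levels C₀, C₁, … of c < k vertices each, in which Cₙ is joined completely to a
-- set Tₙ of c + 1 earlier vertices: one third of each of the three preceding levels (the third s
-- of Cₘ goes into T₍ₘ₊₁₊ₛ₎) and one further vertex.  Tₙ cuts Cₙ off from the rest, and Cₙ together
-- with the further vertex cuts Tₙ into its thirds; so only Cₙ plus one third, about 4k/3 vertices,
-- can be (k+1)-connected.  For complete levels and c = k − 1 the degrees are (c − 1) + (c + 1) + c
-- = 3k − 3.  For the second part each third of a level is split into two halves without edges
-- between them, which costs k/6 in the degree; then the at most k vertices outside one of the four
-- thirds of a remaining piece separate the two halves of that third, and nothing survives.
-- The top of the tower has fewer than 2k vertices of smaller degree.  Gluing two copies of the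
-- graph along k of these vertices repairs the glued ones and leaves fewer bad vertices in total,
-- so that finitely many repetitions remove them all.

module Submission where

open import Defs hiding (sym)
open import Data.Bool.Base using (Bool; true)
open import Data.Empty using (⊥; ⊥-elim)
open import Data.Fin.Base as Fin using (Fin; toℕ; zero; suc; combine; remQuot; opposite)
open import Data.Fin.Properties as Fin using (injective⇒≤; toℕ<n; toℕ-injective; toℕ-combine; combine-remQuot; remQuot-combine)
open import Data.Fin.Subset as Subset using (Subset; inside; outside; ∣_∣; _─_)
open import Data.Fin.Subset.Properties as Subset using (x∈p∧x∉q⇒x∈p─q; p─q⊆p)
open import Data.List.Base using (List; []; _∷_; _++_; map; filter; length; lookup; take; drop; upTo; allFin; cartesianProduct)
import Data.List.Membership.DecPropositional as DecMembership
open import Data.List.Membership.Propositional using (_∈_; _∉_)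
open import Data.List.Membership.Propositional.Properties using (∈-lookup; ∈-map⁺; ∈-map⁻; ∈-filter⁺; ∈-filter⁻; ∈-++⁺ˡ; ∈-++⁺ʳ; ∈-++⁻; ∈-upTo⁺; ∈-upTo⁻; ∈-allFin; ∈-cartesianProduct⁺; ∈-cartesianProduct⁻)
open import Data.List.Properties using (length-map; length-filter; length-++; length-take; length-drop; take++drop≡id; map-++; length-tabulate; length-upTo)
open import Data.List.Relation.Binary.Disjoint.Propositional using (Disjoint)
open import Data.List.Relation.Binary.Subset.Propositional using (_⊆_)
open import Data.List.Relation.Unary.All as All using (All; []; _∷_)
open import Data.List.Relation.Unary.All.Properties as All using (all-filter)
open import Data.List.Relation.Unary.AllPairs using ([]; _∷_)
open import Data.List.Relation.Unary.Any using (here; there; index)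
open import Data.List.Relation.Unary.Any.Properties using (lookup-index)
open import Data.List.Relation.Unary.Unique.Propositional using (Unique)
open import Data.List.Relation.Unary.Unique.Propositional.Properties as Unique using ()
open import Data.Nat.Base using (ℕ; suc; _≤_; _<_; s≤s; z≤n; zero; _+_; _*_; _∸_; _/_; >-nonZero)
open import Data.Nat.DivMod using (m<n⇒m/n≡0; m<n*o⇒m/o<n; /-monoˡ-≤; m*n/n≡m; m≡m%n+[m/n]*n; m%n<n; m/n*n≤m)
open import Data.Nat.Properties as ℕ
open import Data.Nat.Solver using (module +-*-Solver)
open import Data.Product.Base using (Σ; _×_; _,_; proj₁; proj₂; ∃)
open import Data.Product.Properties as Product using ()
open import Data.Sum.Base using (_⊎_; inj₁; inj₂)
open import Data.Sum.Properties as Sum using (inj₁-injective; inj₂-injective; ≡-dec)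
open import Data.Unit.Base using (⊤; tt)
open import Data.Vec.Base as Vec using ([]; _∷_; here; there; tabulate)
open import Data.Vec.Properties using (lookup∘tabulate; []=⇒lookup; lookup⇒[]=)
open import Function.Base using (_∘_)
open import Relation.Binary.Definitions using (DecidableEquality)
open import Relation.Binary.PropositionalEquality.Core using (_≡_; refl; sym; trans; cong; cong₂; subst; _≢_)
open import Relation.Nullary using (¬_; Dec; yes; no; _×-dec_; ¬?; does; _⊎-dec_; _→-dec_)
open import Relation.Nullary.Decidable using (dec-true; dec-false; does-⇔; map′; decidable-stable)

-- Lists without repetition.

lookup-injective : ∀ {A : Set} {xs : List A} → Unique xs →
  ∀ {i j} → lookup xs i ≡ lookup xs j → i ≡ j
lookup-injective (_ ∷ _)   {Fin.zero}  {Fin.zero}  _ = refl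
lookup-injective (x∉ ∷ _)  {Fin.zero}  {Fin.suc j} e = ⊥-elim (All.lookup x∉ (∈-lookup j) e)
lookup-injective (x∉ ∷ _)  {Fin.suc i} {Fin.zero}  e = ⊥-elim (All.lookup x∉ (∈-lookup i) (sym e))
lookup-injective (_ ∷ uxs) {Fin.suc i} {Fin.suc j} e = cong Fin.suc (lookup-injective uxs e)

length-⊆ : ∀ {A : Set} {xs ys : List A} → Unique xs → xs ⊆ ys → length xs ≤ length ys
length-⊆ {xs = xs} {ys} uxs xs⊆ys = injective⇒≤ {f = position} λ {i} {j} e →
  lookup-injective uxs (trans (found i) (trans (cong (lookup ys) e) (sym (found j))))
  where
  position : Fin (length xs) → Fin (length ys)
  position i = index (xs⊆ys (∈-lookup i))
  found : ∀ i → lookup xs i ≡ lookup ys (position i)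
  found i = lookup-index (xs⊆ys (∈-lookup i))

-- Linked subgraphs and bounds on their size.

data Path {V : Set} (W : V → Set) (E : V → V → Set) : V → V → Set where
  stop : ∀ {u} → W u → Path W E u u
  move : ∀ {u w v} → W u → E u w → Path W E w v → Path W E u v

source : ∀ {V : Set} {W : V → Set} {E : V → V → Set} {u v} → Path W E u v → W u
source (stop w)     = w
source (move w _ _) = w

-- A `(k+1)`-connected subgraph without its size condition. Membership is an arbitrary predicate and
-- the deleted set is a list, possibly with repetitions or non-members, which suits infinite vertex
-- types as well.
record Linked (k : ℕ) {V : Set} (Adj : V → V → Set) : Set₁ where
  field
    mem      : V → Set
    edge     : V → V → Set
    edge⇒adj : ∀ {u v} → edge u v → Adj u v
    linked   : ∀ (X : List V) → length X ≤ k → ∀ {u v} → mem u → u ∉ X → mem v → v ∉ X →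
               Path (λ x → mem x × x ∉ X) edge u v

module _ (k β : ℕ) {V : Set} (Adj : V → V → Set) where

  open Linked

  -- Refuting a set of more than β members, instead of bounding a cardinality, makes
  -- case distinctions on arbitrary propositions available in every proof below.
  Bounded : (V → Set) → Set₁
  Bounded P = (H : Linked k Adj) → (∀ {x} → mem H x → P x) →
    ∀ {ws} → Unique ws → All (mem H) ws → ¬ (β < length ws)

  bounded-⊆ : ∀ {P Q : V → Set} → (∀ {x} → P x → Q x) → Bounded Q → Bounded P
  bounded-⊆ P⊆Q bQ H H⊆P = bQ H (P⊆Q ∘ H⊆P)

  bounded-list : ∀ {P : V → Set} (cs : List V) → length cs ≤ β → (∀ {x} → P x → x ∈ cs) → Bounded P
  bounded-list cs ≤β P⊆cs H H⊆P uws ws⊆H β< =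
    <⇒≱ β< (≤-trans (length-⊆ uws (P⊆cs ∘ H⊆P ∘ All.lookup ws⊆H)) ≤β)

  -- Two distinct members are joined by a path with nothing deleted, and its first edge would lie
  -- inside an independent set.
  bounded-independent : 1 ≤ β → ∀ {P : V → Set} → (∀ {x y} → P x → P y → ¬ Adj x y) → Bounded P
  bounded-independent 1≤β indep H H⊆P {[]} _ _ ()
  bounded-independent 1≤β indep H H⊆P {_ ∷ []} _ _ β<1 = <⇒≱ β<1 1≤β
  bounded-independent 1≤β indep H H⊆P {x ∷ y ∷ _} ((x≢y ∷ _) ∷ _) (x∈ ∷ y∈ ∷ _) _
    with linked H [] z≤n x∈ (λ ()) y∈ (λ ())
  ... | stop _     = x≢y refl
  ... | move _ e p = indep (H⊆P x∈) (H⊆P (proj₁ (source p))) (edge⇒adj H e)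

  -- If some member `x` lies outside `B`, then every member lies in `A`: a path from `x` to a vertex
  -- outside `A` would have to change sides at a vertex of the overlap, and the overlap has been
  -- deleted. So all members lie in `A`, or all lie in `B`.
  bounded-split : ∀ {P A B : V → Set} → (∀ x → Dec (A x)) → (∀ x → Dec (B x)) →
    (∀ {x} → P x → A x ⊎ B x) →
    (∀ {x y} → P x → P y → Adj x y → (A x × A y) ⊎ (B x × B y)) →
    (X : List V) → length X ≤ k → (∀ {x} → P x → A x → B x → x ∈ X) →
    Bounded (λ x → P x × A x) → Bounded (λ x → P x × B x) → Bounded P
  bounded-split {P} {A} {B} A? B? cover sides X ≤k A∩B⊆X bA bB H H⊆P uws ws⊆H β< =
    bB H H⊆B uws ws⊆H β<
    where
    AB? : ∀ x → Dec (A x × B x)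
    AB? x = A? x ×-dec B? x

    -- Elements of `X` outside the overlap are kept, so a member missing from one side is sure to
    -- survive the deletion.
    sep : List V
    sep = filter AB? X

    sep≤k : length sep ≤ k
    sep≤k = ≤-trans (length-filter AB? X) ≤k

    sep⊆AB : ∀ {x} → x ∈ sep → A x × B x
    sep⊆AB = proj₂ ∘ ∈-filter⁻ AB? {xs = X}

    W : V → Set
    W x = mem H x × x ∉ sep

    across : ∀ {u w} → W u → mem H w → edge H u w → A u → A w
    across (u∈ , u∉) w∈ e Au with sides (H⊆P u∈) (H⊆P w∈) (edge⇒adj H e)
    ... | inj₁ (_ , Aw) = Aw
    ... | inj₂ (Bu , _) = ⊥-elim (u∉ (∈-filter⁺ AB? (A∩B⊆X (H⊆P u∈) Au Bu) (Au , Bu)))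

    stays : ∀ {u v} → Path W (edge H) u v → A u → A v
    stays (stop _)     Au = Au
    stays (move w e p) Au = stays p (across w (proj₁ (source p)) e Au)

    only-A : ∀ {x y} → mem H x → mem H y → A x → ¬ B x → A y
    only-A {x} {y} x∈ y∈ Ax ¬Bx with A? y
    ... | yes Ay = Ay
    ... | no ¬Ay = stays (linked H sep sep≤k x∈ (¬Bx ∘ proj₂ ∘ sep⊆AB) y∈ (¬Ay ∘ proj₁ ∘ sep⊆AB)) Ax

    H⊆B : ∀ {x} → mem H x → P x × B x
    H⊆B {x} x∈ with B? x | cover (H⊆P x∈)
    ... | yes Bx | _       = H⊆P x∈ , Bx
    ... | no ¬Bx | inj₂ Bx = ⊥-elim (¬Bx Bx)
    ... | no ¬Bx | inj₁ Ax =
      ⊥-elim (bA H (λ y∈ → H⊆P y∈ , only-A x∈ y∈ Ax ¬Bx) uws ws⊆H β<)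

module _ {k β : ℕ} {V W : Set} {AdjV : V → V → Set} {AdjW : W → W → Set}
         (f : W → V) {P : V → Set} {Q : W → Set} (Q? : ∀ w → Dec (Q w))
         (f-inj : ∀ {x y} → Q x → Q y → f x ≡ f y → x ≡ y)
         (reflect : ∀ {x y} → Q x → Q y → AdjV (f x) (f y) → AdjW x y)
         (onto : ∀ {x} → P x → ∃ λ w → Q w × f w ≡ x) where

  open Linked

  -- A linked subgraph inside `P` pulls back along `f`: its vertices have preimages in `Q`, and its
  -- edges reflect. This serves the two glued copies, the bags of the tower and the numbering of the
  -- vertices.
  bounded-transfer : Bounded k β AdjW Q → Bounded k β AdjV P
  bounded-transfer bQ H H⊆P {ws} uws ws⊆H β< =
    bQ H′ proj₁ {pull ws⊆H}
      (Unique.map⁻ {f = f} (subst Unique (sym (f-pull ws⊆H)) uws)) (pull∈ ws⊆H)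
      (subst (β <_) (trans (cong length (sym (f-pull ws⊆H))) (length-map f (pull ws⊆H))) β<)
    where
    W′ : List W → W → Set
    W′ X w = (Q w × mem H (f w)) × w ∉ X

    -- Only the elements of `X` in `Q` are deleted: `f` is injective on `Q` alone, and the image of
    -- another vertex could hit a survivor.
    push : List W → List V
    push X = map f (filter Q? X)

    ∉-push : ∀ {X w} → Q w → w ∉ X → f w ∉ push X
    ∉-push {X} Qw w∉X fw∈ with ∈-map⁻ f fw∈
    ... | w′ , w′∈ , e with ∈-filter⁻ Q? {xs = X} w′∈
    ...   | w′∈X , Qw′ = w∉X (subst (_∈ X) (sym (f-inj Qw Qw′ e)) w′∈X)

    pull-path : ∀ {X u v} → Q u → Q v →
      Path (λ x → mem H x × x ∉ push X) (edge H) (f u) (f v) →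
      Path (W′ X) (λ x y → (Q x × Q y) × edge H (f x) (f y)) u v
    pull-path {X} {u} {v} Qu Qv = go refl refl Qu Qv
      where
      avoids : ∀ {x w} → f w ≡ x → Q w → mem H x × x ∉ push X → W′ X w
      avoids refl Qw (x∈ , x∉) = (Qw , x∈) , λ w∈X → x∉ (∈-map⁺ f (∈-filter⁺ Q? w∈X Qw))
      go : ∀ {x y u v} → f u ≡ x → f v ≡ y → Q u → Q v →
        Path (λ x → mem H x × x ∉ push X) (edge H) x y →
        Path (W′ X) (λ x y → (Q x × Q y) × edge H (f x) (f y)) u v
      go fu fv Qu Qv (stop w) with f-inj Qu Qv (trans fu (sym fv))
      ... | refl = stop (avoids fu Qu w)
      go refl fv Qu Qv (move w e p) with onto (H⊆P (proj₁ (source p)))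
      ... | m , Qm , refl = move (avoids refl Qu w) ((Qu , Qm) , e) (go refl fv Qm Qv p)

    H′ : Linked k AdjW
    H′ = record
      { mem = λ w → Q w × mem H (f w)
      ; edge = λ x y → (Q x × Q y) × edge H (f x) (f y)
      ; edge⇒adj = λ { ((Qx , Qy) , e) → reflect Qx Qy (edge⇒adj H e) }
      ; linked = λ { X ≤k (Qu , u∈) u∉ (Qv , v∈) v∉ →
          pull-path Qu Qv (linked H (push X)
            (≤-trans (≤-trans (≤-reflexive (length-map f (filter Q? X))) (length-filter Q? X)) ≤k)
            u∈ (∉-push Qu u∉) v∈ (∉-push Qv v∉)) }
      }

    pull : ∀ {xs} → All (mem H) xs → List W
    pull []         = []
    pull (x∈ ∷ xs∈) = proj₁ (onto (H⊆P x∈)) ∷ pull xs∈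

    f-pull : ∀ {xs} (xs∈ : All (mem H) xs) → map f (pull xs∈) ≡ xs
    f-pull []         = refl
    f-pull (x∈ ∷ xs∈) = cong₂ _∷_ (proj₂ (proj₂ (onto (H⊆P x∈)))) (f-pull xs∈)

    pull∈ : ∀ {xs} (xs∈ : All (mem H) xs) → All (λ w → Q w × mem H (f w)) (pull xs∈)
    pull∈ []         = []
    pull∈ (x∈ ∷ xs∈) with onto (H⊆P x∈)
    ... | w , Qw , refl = (Qw , x∈) ∷ pull∈ xs∈

-- Disjoint unions of lists, degrees, and graphs still under repair.

Unique-++⁻ˡ : ∀ {A : Set} (xs {ys} : List A) → Unique (xs ++ ys) → Unique xs
Unique-++⁻ˡ []       _        = []
Unique-++⁻ˡ (x ∷ xs) (x∉ ∷ u) = All.++⁻ˡ xs x∉ ∷ Unique-++⁻ˡ xs u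

module _ {A B : Set} {as : List A} {bs : List B} where

  inj₁-∈ : ∀ {a} → inj₁ a ∈ map inj₁ as ++ map inj₂ bs → a ∈ as
  inj₁-∈ p with ∈-++⁻ (map inj₁ as) p
  ... | inj₁ q with ∈-map⁻ inj₁ q
  ...   | _ , a∈ , refl = a∈
  inj₁-∈ p | inj₂ q with ∈-map⁻ inj₂ q
  ...   | _ , _ , ()

  inj₂-∈ : ∀ {b} → inj₂ b ∈ map inj₁ as ++ map inj₂ bs → b ∈ bs
  inj₂-∈ p with ∈-++⁻ (map inj₁ as) p
  ... | inj₂ q with ∈-map⁻ inj₂ q
  ...   | _ , b∈ , refl = b∈
  inj₂-∈ p | inj₁ q with ∈-map⁻ inj₁ q
  ...   | _ , _ , ()

  map-disjoint : Disjoint (map (inj₁ {B = B}) as) (map inj₂ bs)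
  map-disjoint (p , q) with ∈-map⁻ inj₁ p | ∈-map⁻ inj₂ q
  ... | _ , _ , refl | _ , _ , ()

module _ {V : Set} (Adj : V → V → Set) (vs : List V) where

  Nbrs : V → List V → Set
  Nbrs v ns = Unique ns × All (λ w → w ∈ vs × Adj v w) ns

  HasDegree : ℕ → V → Set
  HasDegree δ v = ∃ λ ns → Nbrs v ns × δ ≤ length ns

  -- Neighbours outside bs are counted twice: they are the ones that double
  -- when two copies of the graph are glued along a set of vertices of bs.
  HalfDegree : ℕ → List V → V → Set
  HalfDegree δ bs v = ∃ λ outs → ∃ λ ins → Nbrs v (outs ++ ins) × All (_∉ bs) outs ×
    δ ≤ length (outs ++ ins) + length outs

-- Only vertices of `bs` may have degree below `δ`. The root is never glued and keeps degree at most
-- `r`, which later makes the minimum degree exact.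
record Piece (k δ β r : ℕ) : Set₁ where
  field
    V         : Set
    _≈?_      : DecidableEquality V
    Adj       : V → V → Set
    Adj?      : ∀ u v → Dec (Adj u v)
    Adj-sym   : ∀ {u v} → Adj u v → Adj v u
    Adj-irrefl : ∀ {v} → ¬ Adj v v
    vs        : List V
    vs-unique : Unique vs
    bounded   : Bounded k β Adj (_∈ vs)
    bs        : List V
    degrees   : ∀ {v} → v ∈ vs → HasDegree Adj vs δ v ⊎ (v ∈ bs × HalfDegree Adj vs δ bs v)
    root      : V
    root∈vs   : root ∈ vs
    root∉bs   : root ∉ bs
    rootNbrs  : List V
    root-complete : ∀ {w} → w ∈ vs → Adj root w → w ∈ rootNbrs
    root-degree   : length rootNbrs ≤ r

-- Gluing two copies along deficient vertices.

-- The second copy of a vertex v of T is inj₁ v; inj₂ v is then not a vertex.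
module Doubling {k δ β r : ℕ} (P : Piece k δ β r) where

  open Piece P
  open DecMembership _≈?_ using (_∈?_)

  -- At most `k` vertices, few enough to be the separator in `bounded-split`.
  T : List V
  T = take k bs

  T⊆bs : ∀ {v} → v ∈ T → v ∈ bs
  T⊆bs {v} v∈ = subst (v ∈_) (take++drop≡id k bs) (∈-++⁺ˡ v∈)

  rest⊆bs : ∀ {v} → v ∈ drop k bs → v ∈ bs
  rest⊆bs {v} v∈ = subst (v ∈_) (take++drop≡id k bs) (∈-++⁺ʳ T v∈)

  bs-split : ∀ {v} → v ∈ bs → v ∉ T → v ∈ drop k bs
  bs-split {v} v∈ v∉T with ∈-++⁻ T (subst (v ∈_) (sym (take++drop≡id k bs)) v∈)
  ... | inj₁ v∈T = ⊥-elim (v∉T v∈T)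
  ... | inj₂ v∈r = v∈r

  V² : Set
  V² = V ⊎ V

  -- The mixed cases are edges of the second copy whose `inj₁` end is a glued vertex.
  Adj² : V² → V² → Set
  Adj² (inj₁ u) (inj₁ v) = Adj u v
  Adj² (inj₁ u) (inj₂ v) = u ∈ T × Adj u v
  Adj² (inj₂ u) (inj₁ v) = v ∈ T × Adj u v
  Adj² (inj₂ u) (inj₂ v) = Adj u v

  Adj²? : ∀ u v → Dec (Adj² u v)
  Adj²? (inj₁ u) (inj₁ v) = Adj? u v
  Adj²? (inj₁ u) (inj₂ v) = (u ∈? T) ×-dec Adj? u v
  Adj²? (inj₂ u) (inj₁ v) = (v ∈? T) ×-dec Adj? u v
  Adj²? (inj₂ u) (inj₂ v) = Adj? u v

  Adj²-sym : ∀ {u v} → Adj² u v → Adj² v u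
  Adj²-sym {inj₁ _} {inj₁ _} a       = Adj-sym a
  Adj²-sym {inj₁ _} {inj₂ _} (t , a) = t , Adj-sym a
  Adj²-sym {inj₂ _} {inj₁ _} (t , a) = t , Adj-sym a
  Adj²-sym {inj₂ _} {inj₂ _} a       = Adj-sym a

  Adj²-irrefl : ∀ {v} → ¬ Adj² v v
  Adj²-irrefl {inj₁ _} = Adj-irrefl
  Adj²-irrefl {inj₂ _} = Adj-irrefl

  ∉T? : ∀ v → Dec (v ∉ T)
  ∉T? v = ¬? (v ∈? T)

  vs² : List V²
  vs² = map inj₁ vs ++ map inj₂ (filter ∉T? vs)

  bs² : List V²
  bs² = map inj₁ (drop k bs) ++ map inj₂ (drop k bs)

  first∈ : ∀ {v} → v ∈ vs → inj₁ v ∈ vs²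
  first∈ v∈ = ∈-++⁺ˡ (∈-map⁺ inj₁ v∈)

  second∈ : ∀ {v} → v ∈ vs → v ∉ T → inj₂ v ∈ vs²
  second∈ v∈ v∉T = ∈-++⁺ʳ (map inj₁ vs) (∈-map⁺ inj₂ (∈-filter⁺ ∉T? v∈ v∉T))

  first-alive : ∀ {v} → inj₁ v ∈ vs² → v ∈ vs
  first-alive = inj₁-∈

  second-alive : ∀ {v} → inj₂ v ∈ vs² → v ∈ vs × v ∉ T
  second-alive p = ∈-filter⁻ ∉T? {xs = vs} (inj₂-∈ {as = vs} p)

  vs²-unique : Unique vs²
  vs²-unique = Unique.++⁺ (Unique.map⁺ inj₁-injective vs-unique)
    (Unique.map⁺ inj₂-injective (Unique.filter⁺ ∉T? vs-unique)) map-disjoint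

  second : V → V²
  second v with v ∈? T
  ... | yes _ = inj₁ v
  ... | no  _ = inj₂ v

  second-injective : ∀ {u v} → second u ≡ second v → u ≡ v
  second-injective {u} {v} e with u ∈? T | v ∈? T
  second-injective refl | yes _ | yes _ = refl
  second-injective ()   | yes _ | no  _
  second-injective ()   | no  _ | yes _
  second-injective refl | no  _ | no  _ = refl

  second-reflects : ∀ {u v} → Adj² (second u) (second v) → Adj u v
  second-reflects {u} {v} a with u ∈? T | v ∈? T
  ... | yes _ | yes _ = a
  ... | yes _ | no  _ = proj₂ a
  ... | no  _ | yes _ = proj₂ a
  ... | no  _ | no  _ = a

  second-T : ∀ {v} → v ∈ T → second v ≡ inj₁ v
  second-T {v} v∈T with v ∈? T
  ... | yes _  = refl
  ... | no v∉T = ⊥-elim (v∉T v∈T)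

  second-rest : ∀ {v} → v ∉ T → second v ≡ inj₂ v
  second-rest {v} v∉T with v ∈? T
  ... | yes v∈T = ⊥-elim (v∉T v∈T)
  ... | no _    = refl

  second-vs : ∀ {v} → v ∈ vs → second v ∈ vs²
  second-vs {v} v∈ with v ∈? T
  ... | yes _  = first∈ v∈
  ... | no v∉T = second∈ v∈ v∉T

  second-Adj : ∀ {u v} → Adj u v → Adj² (inj₂ u) (second v)
  second-Adj {u} {v} a with v ∈? T
  ... | yes v∈T = v∈T , a
  ... | no _    = a

  InFirst InSecond : V² → Set
  InFirst x  = ∃ λ v → inj₁ v ≡ x
  InSecond x = ∃ λ v → second v ≡ x

  inFirst? : ∀ x → Dec (InFirst x)
  inFirst? (inj₁ v) = yes (v , refl)
  inFirst? (inj₂ v) = no λ { (_ , ()) }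

  inSecond? : ∀ x → Dec (InSecond x)
  -- `second` can reach `x` only from the vertex underlying `x`, so a single test decides.
  inSecond? x with ≡-dec _≈?_ _≈?_ (second (from x)) x
    where
    from : V² → V
    from (inj₁ v) = v
    from (inj₂ v) = v
  inSecond? x        | yes e = yes (_ , e)
  inSecond? (inj₁ v) | no ¬e = no λ { (w , e) → ¬e (fix e) }
    where
    fix : ∀ {w} → second w ≡ inj₁ v → second v ≡ inj₁ v
    fix {w} e with w ∈? T
    fix refl | yes w∈T = second-T w∈T
  inSecond? (inj₂ v) | no ¬e = no λ { (w , e) → ¬e (fix e) }
    where
    fix : ∀ {w} → second w ≡ inj₂ v → second v ≡ inj₂ v
    fix {w} e with w ∈? T
    fix refl | no w∉T = second-rest w∉T

  overlap⊆T : ∀ {x} → InFirst x → InSecond x → x ∈ map inj₁ T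
  overlap⊆T (v , refl) (w , e) with w ∈? T
  overlap⊆T (v , refl) (w , refl) | yes w∈T = ∈-map⁺ inj₁ w∈T

  vs²-cover : ∀ {x} → x ∈ vs² → InFirst x ⊎ InSecond x
  vs²-cover {inj₁ v} _  = inj₁ (v , refl)
  vs²-cover {inj₂ v} x∈ = inj₂ (v , second-rest (proj₂ (second-alive x∈)))

  vs²-sides : ∀ {x y} → x ∈ vs² → y ∈ vs² → Adj² x y →
    (InFirst x × InFirst y) ⊎ (InSecond x × InSecond y)
  vs²-sides {inj₁ u} {inj₁ v} _ _ _ = inj₁ ((u , refl) , (v , refl))
  vs²-sides {inj₁ u} {inj₂ v} _ y∈ (u∈T , _) =
    inj₂ ((u , second-T u∈T) , (v , second-rest (proj₂ (second-alive y∈))))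
  vs²-sides {inj₂ u} {inj₁ v} x∈ _ (v∈T , _) =
    inj₂ ((u , second-rest (proj₂ (second-alive x∈))) , (v , second-T v∈T))
  vs²-sides {inj₂ u} {inj₂ v} x∈ y∈ _ =
    inj₂ ((u , second-rest (proj₂ (second-alive x∈))) , (v , second-rest (proj₂ (second-alive y∈))))

  second-alive′ : ∀ {v} → second v ∈ vs² → v ∈ vs
  second-alive′ {v} p with v ∈? T
  ... | yes _ = first-alive p
  ... | no _  = proj₁ (second-alive p)

  -- The copies meet only in `T` and every edge lies inside one of them, so `T` separates them; each
  -- copy inherits the bound of the piece.
  bounded² : Bounded k β Adj² (_∈ vs²)
  bounded² = bounded-split k β Adj² inFirst? inSecond? vs²-cover vs²-sides
    (map inj₁ T) (≤-trans (≤-reflexive (trans (length-map inj₁ T) (length-take k bs))) (m⊓n≤m k _))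
    (λ _ → overlap⊆T)
    (bounded-transfer inj₁ (_∈? vs) (λ _ _ → inj₁-injective) (λ _ _ a → a)
      (λ { (x∈ , v , refl) → v , first-alive x∈ , refl }) bounded)
    (bounded-transfer second (_∈? vs) (λ _ _ → second-injective) (λ _ _ → second-reflects)
      (λ { (x∈ , v , refl) → v , second-alive′ x∈ , refl }) bounded)

  first-nbrs : ∀ {v ns} → Nbrs Adj vs v ns → Nbrs Adj² vs² (inj₁ v) (map inj₁ ns)
  first-nbrs (u , a) = Unique.map⁺ inj₁-injective u ,
    All.map⁺ (All.map (λ { (w∈ , adj) → first∈ w∈ , adj }) a)

  second-nbrs : ∀ {v ns} → Nbrs Adj vs v ns → Nbrs Adj² vs² (inj₂ v) (map second ns)
  second-nbrs (u , a) = Unique.map⁺ second-injective u ,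
    All.map⁺ (All.map (λ { (w∈ , adj) → second-vs w∈ , second-Adj adj }) a)

  -- Neighbours outside `bs` lie outside `T`, so a glued vertex sees each of them once in either
  -- copy. This accounts for the second summand in `HalfDegree`.
  glued-degree : ∀ {v} → v ∈ T → HalfDegree Adj vs δ bs v → HasDegree Adj² vs² δ (inj₁ v)
  glued-degree {v} v∈T (outs , ins , (u , a) , out , δ≤) =
    map inj₁ (outs ++ ins) ++ map inj₂ outs ,
    ( Unique.++⁺ (Unique.map⁺ inj₁-injective u)
        (Unique.map⁺ inj₂-injective (Unique-++⁻ˡ outs u)) map-disjoint
    , All.++⁺ (proj₂ (first-nbrs {v} (u , a)))
        (All.map⁺ (All.map (λ { ((w∈ , adj) , w∉) → second∈ w∈ (w∉ ∘ T⊆bs) , v∈T , adj })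
          (All.zip (All.++⁻ˡ outs a , out)))) ) ,
    ≤-trans δ≤ (≤-reflexive (sym (trans (length-++ (map inj₁ (outs ++ ins)))
      (cong₂ _+_ (length-map inj₁ (outs ++ ins)) (length-map inj₂ outs)))))

  -- An unglued vertex keeps its half degree, because a vertex copied into `bs²` was already in
  -- `bs`.
  half-transport : ∀ {f : V → V²} {v x} →
    (∀ {ns} → Nbrs Adj vs v ns → Nbrs Adj² vs² x (map f ns)) →
    (∀ {w} → f w ∈ bs² → w ∈ bs) →
    HalfDegree Adj vs δ bs v → HalfDegree Adj² vs² δ bs² x
  half-transport {f} {x = x} nbrs f-bs (outs , ins , ns , out , δ≤) =
    map f outs , map f ins , subst (Nbrs Adj² vs² x) (map-++ f outs ins) (nbrs ns) ,
    All.map⁺ (All.map (λ w∉ → w∉ ∘ f-bs) out) ,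
    ≤-trans δ≤ (≤-reflexive (sym (cong₂ _+_
      (trans (cong length (sym (map-++ f outs ins))) (length-map f (outs ++ ins))) (length-map f outs))))

  has-transport : ∀ {f : V → V²} {v x} →
    (∀ {ns} → Nbrs Adj vs v ns → Nbrs Adj² vs² x (map f ns)) →
    HasDegree Adj vs δ v → HasDegree Adj² vs² δ x
  has-transport {f} nbrs (ns , n , δ≤) =
    map f ns , nbrs n , ≤-trans δ≤ (≤-reflexive (sym (length-map f ns)))

  first-bs : ∀ {w} → inj₁ w ∈ bs² → w ∈ bs
  first-bs p = rest⊆bs (inj₁-∈ p)

  second-bs : ∀ {w} → second w ∈ bs² → w ∈ bs
  second-bs {w} p with w ∈? T
  ... | yes w∈T = T⊆bs w∈T
  ... | no _    = rest⊆bs (inj₂-∈ {as = drop k bs} p)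

  degrees² : ∀ {x} → x ∈ vs² → HasDegree Adj² vs² δ x ⊎ (x ∈ bs² × HalfDegree Adj² vs² δ bs² x)
  degrees² {inj₁ v} x∈ with degrees (first-alive x∈)
  ... | inj₁ d = inj₁ (has-transport {x = inj₁ v} first-nbrs d)
  ... | inj₂ (v∈bs , h) with v ∈? T
  ...   | yes v∈T = inj₁ (glued-degree v∈T h)
  ...   | no v∉T  = inj₂ (∈-++⁺ˡ (∈-map⁺ inj₁ (bs-split v∈bs v∉T)) ,
    half-transport {x = inj₁ v} first-nbrs first-bs h)
  degrees² {inj₂ v} x∈ with second-alive x∈
  ... | v∈vs , v∉T with degrees v∈vs
  ...   | inj₁ d = inj₁ (has-transport {x = inj₂ v} second-nbrs d)
  ...   | inj₂ (v∈bs , h) =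
    inj₂ (∈-++⁺ʳ (map inj₁ (drop k bs)) (∈-map⁺ inj₂ (bs-split v∈bs v∉T)) ,
      half-transport {x = inj₂ v} second-nbrs second-bs h)

  double : Piece k δ β r
  double = record
    { V = V² ; _≈?_ = ≡-dec _≈?_ _≈?_ ; Adj = Adj² ; Adj? = Adj²?
    ; Adj-sym = λ {u} {v} → Adj²-sym {u} {v} ; Adj-irrefl = λ {v} → Adj²-irrefl {v}
    ; vs = vs² ; vs-unique = vs²-unique ; bounded = bounded² ; bs = bs² ; degrees = degrees²
    ; root = inj₁ root ; root∈vs = first∈ root∈vs ; root∉bs = root∉bs ∘ first-bs
    ; rootNbrs = map inj₁ rootNbrs
    ; root-complete = λ
        { {inj₁ w} w∈ a       → ∈-map⁺ inj₁ (root-complete (first-alive w∈) a)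
        -- The root lies outside `bs`, hence outside `T`, and gains no neighbour.
        ; {inj₂ w} _  (t , _) → ⊥-elim (root∉bs (T⊆bs t)) }
    ; root-degree = ≤-trans (≤-reflexive (length-map inj₁ rootNbrs)) root-degree
    }

  length-bs² : length bs² ≡ (length bs ∸ k) + (length bs ∸ k)
  length-bs² = trans (length-++ (map inj₁ (drop k bs))) (cong₂ _+_
    (trans (length-map inj₁ (drop k bs)) (length-drop k bs))
    (trans (length-map inj₂ (drop k bs)) (length-drop k bs)))

-- For `b` at least `k`, the excess `b - k` is below `k`, so twice the excess is below
-- `k + (b - k)`. This is where having fewer than `2k` deficient vertices matters.
halving : ∀ {k b} → 1 ≤ b → b < k + k → (b ∸ k) + (b ∸ k) < b
halving {k} {b} 1≤b b<2k with ≤-total b k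
... | inj₁ b≤k rewrite m≤n⇒m∸n≡0 b≤k = 1≤b
... | inj₂ k≤b = begin-strict
  (b ∸ k) + (b ∸ k)  <⟨ +-monoˡ-< (b ∸ k) (m<n+o⇒m∸n<o b k {{>-nonZero 0<k}} b<2k) ⟩
  k + (b ∸ k)        ≡⟨ m+[n∸m]≡n k≤b ⟩
  b                  ∎
  where
  open ≤-Reasoning
  0<k : 0 < k
  0<k = +-cancelˡ-< k 0 k (≤-<-trans (≤-trans (≤-reflexive (+-identityʳ k)) k≤b) b<2k)

-- By `halving` each doubling shortens `bs`, so the bound `n` can drop and the length stays below
-- `2k`.
close : ∀ {k δ β r} (P : Piece k δ β r) → length (Piece.bs P) < k + k →
  ∃ λ (Q : Piece k δ β r) → Piece.bs Q ≡ []
close P = go _ P ≤-refl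
  where
  go : ∀ {k δ β r} n (P : Piece k δ β r) → length (Piece.bs P) ≤ n → length (Piece.bs P) < k + k →
    ∃ λ (Q : Piece k δ β r) → Piece.bs Q ≡ []
  go n P ≤n <2k with Piece.bs P in eq
  go n P ≤n <2k | [] = P , eq
  go {k} (suc n) P ≤n <2k | b ∷ bs =
    go n double (≤-pred (≤-trans smaller ≤n)) (<-trans smaller <2k)
    where
    open Doubling P
    smaller : length bs² < suc (length bs)
    smaller = ≤-trans (s≤s (≤-reflexive (trans length-bs² (cong (λ x → (x ∸ k) + (x ∸ k)) (cong length eq)))))
      (halving {k} (s≤s z≤n) <2k)

-- Finite subsets as lists.

members : ∀ {n} → Subset n → List (Fin n)
members []            = []
members (inside ∷ p)  = Fin.zero ∷ map Fin.suc (members p)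
members (outside ∷ p) = map Fin.suc (members p)

length-members : ∀ {n} (p : Subset n) → length (members p) ≡ ∣ p ∣
length-members []            = refl
length-members (inside ∷ p)  = cong suc (trans (length-map Fin.suc (members p)) (length-members p))
length-members (outside ∷ p) = trans (length-map Fin.suc (members p)) (length-members p)

∈-members⁺ : ∀ {n} {p : Subset n} {x} → x Subset.∈ p → x ∈ members p
∈-members⁺ here                      = here refl
∈-members⁺ {p = inside ∷ _}  (there x∈) = there (∈-map⁺ Fin.suc (∈-members⁺ x∈))
∈-members⁺ {p = outside ∷ _} (there x∈) = ∈-map⁺ Fin.suc (∈-members⁺ x∈)

∈-members⁻ : ∀ {n} (p : Subset n) {x} → x ∈ members p → x Subset.∈ p
∈-members⁻ (inside ∷ p) (here refl) = here
∈-members⁻ (inside ∷ p) (there x∈) with ∈-map⁻ Fin.suc x∈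
... | _ , y∈ , refl = there (∈-members⁻ p y∈)
∈-members⁻ (outside ∷ p) x∈ with ∈-map⁻ Fin.suc x∈
... | _ , y∈ , refl = there (∈-members⁻ p y∈)

members-unique : ∀ {n} (p : Subset n) → Unique (members p)
members-unique []            = []
members-unique (inside ∷ p)  =
  All.tabulate (λ x∈ e → zero∉ (subst (_∈ map Fin.suc (members p)) (sym e) x∈)) ∷
  Unique.map⁺ Fin.suc-injective (members-unique p)
  where
  zero∉ : Fin.zero ∉ map Fin.suc (members p)
  zero∉ z∈ with ∈-map⁻ Fin.suc z∈
  ... | _ , _ , ()
members-unique (outside ∷ p) = Unique.map⁺ Fin.suc-injective (members-unique p)

∈-tabulate⁺ : ∀ {n} {f : Fin n → Bool} {x} → f x ≡ true → x Subset.∈ tabulate f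
∈-tabulate⁺ {f = f} {x} e = lookup⇒[]= x (tabulate f) (trans (lookup∘tabulate f x) e)

∈-tabulate⁻ : ∀ {n} {f : Fin n → Bool} {x} → x Subset.∈ tabulate f → f x ≡ true
∈-tabulate⁻ {f = f} {x} x∈ = trans (sym (lookup∘tabulate f x)) ([]=⇒lookup x∈)

does-true : ∀ {A : Set} (a? : Dec A) → does a? ≡ true → A
does-true (yes a) _ = a

x∈p─q⇒x∉q : ∀ {n} (p q : Subset n) {x} → x Subset.∈ (p ─ q) → x Subset.∉ q
x∈p─q⇒x∉q (_ ∷ p)      (inside ∷ q)  (there x∈) (there x∈q) = x∈p─q⇒x∉q p q x∈ x∈q
x∈p─q⇒x∉q (_ ∷ p)      (outside ∷ q) (there x∈) (there x∈q) = x∈p─q⇒x∉q p q x∈ x∈q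

-- From a repaired piece to a `Graph`.

module Realisation {k δ β r : ℕ} (P : Piece k δ β r) (bs≡[] : Piece.bs P ≡ []) where

  open Piece P
  open DecMembership _≈?_ using (_∈?_)

  G : Graph
  G = record
    { n      = length vs
    ; adj    = λ i j → does (Adj? (lookup vs i) (lookup vs j))
    ; sym    = λ i j → does-⇔ (record { to = Adj-sym ; from = Adj-sym ; to-cong = cong _ ; from-cong = cong _ })
        (Adj? (lookup vs i) (lookup vs j)) (Adj? (lookup vs j) (lookup vs i))
    ; irrefl = λ i → dec-false (Adj? _ _) Adj-irrefl
    }

  I : Set
  I = Fin (length vs)

  at : I → V
  at = lookup vs

  at-injective : ∀ {i j} → at i ≡ at j → i ≡ j
  at-injective = lookup-injective vs-unique

  number : V → I
  number v with v ∈? vs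
  ... | yes v∈ = index v∈
  -- Outside `vs` the value is arbitrary; the root shows that there is one.
  ... | no  _  = index root∈vs

  at-number : ∀ {v} → v ∈ vs → at (number v) ≡ v
  at-number {v} v∈ with v ∈? vs
  ... | yes v∈′ = sym (lookup-index v∈′)
  ... | no  v∉  = ⊥-elim (v∉ v∈)

  number-at : ∀ i → number (at i) ≡ i
  number-at i = at-injective (at-number (∈-lookup i))

  has-degree : ∀ {v} → v ∈ vs → HasDegree Adj vs δ v
  has-degree v∈ with degrees v∈
  ... | inj₁ d       = d
  ... | inj₂ (b , _) with subst (_ ∈_) bs≡[] b
  ...   | ()

  deg-≥ : ∀ i → δ ≤ deg G i
  deg-≥ i with has-degree (∈-lookup i)
  ... | ns , (u , a) , δ≤ = begin
    δ                                ≤⟨ δ≤ ⟩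
    length ns                        ≤⟨ length-⊆ u ns⊆ ⟩
    length (map at (members nb))     ≡⟨ length-map at (members nb) ⟩
    length (members nb)              ≡⟨ length-members nb ⟩
    ∣ nb ∣                           ∎
    where
    open ≤-Reasoning
    nb : Subset (length vs)
    nb = nbhd G i
    ns⊆ : ∀ {w} → w ∈ ns → w ∈ map at (members nb)
    ns⊆ {w} w∈ with All.lookup a w∈
    ... | w∈vs , adj-w = subst (_∈ map at (members nb)) (at-number w∈vs)
      (∈-map⁺ at (∈-members⁺ (∈-tabulate⁺ (dec-true (Adj? _ _) (subst (Adj (at i)) (sym (at-number w∈vs)) adj-w)))))

  root-deg-≤ : deg G (number root) ≤ r
  root-deg-≤ = begin
    ∣ nb ∣                           ≡⟨ length-members nb ⟨
    length (members nb)              ≡⟨ length-map at (members nb) ⟨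
    length (map at (members nb))     ≤⟨ length-⊆ (Unique.map⁺ at-injective (members-unique nb)) nb⊆ ⟩
    length rootNbrs                  ≤⟨ root-degree ⟩
    r                                ∎
    where
    open ≤-Reasoning
    nb : Subset (length vs)
    nb = nbhd G (number root)
    nb⊆ : ∀ {w} → w ∈ map at (members nb) → w ∈ rootNbrs
    nb⊆ w∈ with ∈-map⁻ at w∈
    ... | j , j∈ , refl = root-complete (∈-lookup j)
      (subst (λ v → Adj v (at j)) (at-number root∈vs) (does-true (Adj? _ _) (∈-tabulate⁻ (∈-members⁻ nb j∈))))

  AdjI : I → I → Set
  AdjI i j = adj G i j ≡ true

  -- The constant predicate `I` holds everywhere, each index being its own witness.
  bounded-I : Bounded k β AdjI (λ _ → I)
  bounded-I = bounded-transfer number (_∈? vs)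
    (λ {v} {w} v∈ w∈ e → trans (sym (at-number v∈)) (trans (cong at e) (at-number w∈)))
    (λ {v} {w} v∈ w∈ a → subst (λ x → Adj x w) (at-number v∈)
      (subst (Adj (at (number v))) (at-number w∈) (does-true (Adj? _ _) a)))
    (λ {i} _ → at i , ∈-lookup i , number-at i) bounded

  module _ (H : Subgraph G) (conn : KConn k H) where

    toSubset : List I → Subset (length vs)
    toSubset X = tabulate λ i → does (DecMembership._∈?_ Fin._≟_ i X)

    ∣toSubset∣ : ∀ X → ∣ toSubset X ∣ ≤ length X
    ∣toSubset∣ X = ≤-trans (≤-reflexive (sym (length-members (toSubset X))))
      (length-⊆ (members-unique (toSubset X))
        (λ x∈ → does-true (DecMembership._∈?_ Fin._≟_ _ X) (∈-tabulate⁻ (∈-members⁻ (toSubset X) x∈))))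

    ∉-toSubset : ∀ {i X} → i ∉ X → i Subset.∉ toSubset X
    ∉-toSubset {X = X} i∉ i∈ = i∉ (does-true (DecMembership._∈?_ Fin._≟_ _ X) (∈-tabulate⁻ i∈))

    toPath : ∀ X {u v} → Walk (S H ─ toSubset X) (E H) u v →
      Path (λ x → x Subset.∈ S H × x ∉ X) (λ x y → E H x y ≡ true) u v
    toPath X {u} {v} = go
      where
      keep : ∀ {x} → x Subset.∈ (S H ─ toSubset X) → x Subset.∈ S H × x ∉ X
      keep x∈ = p─q⊆p (S H) (toSubset X) x∈ ,
        λ x∈X → x∈p─q⇒x∉q (S H) (toSubset X) x∈
          (∈-tabulate⁺ (dec-true (DecMembership._∈?_ Fin._≟_ _ X) x∈X))
      go : ∀ {u v} → Walk (S H ─ toSubset X) (E H) u v →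
        Path (λ x → x Subset.∈ S H × x ∉ X) (λ x y → E H x y ≡ true) u v
      go (here w)     = stop (keep w)
      go (step w e p) = move (keep w) e (go p)

    linkedH : Linked k AdjI
    linkedH = record
      { mem = Subset._∈ S H
      ; edge = λ x y → E H x y ≡ true
      ; edge⇒adj = E⊆adj H _ _
      ; linked = λ X ≤k u∈ u∉ v∈ v∉ → toPath X
          (proj₂ conn (toSubset X) (≤-trans (∣toSubset∣ X) ≤k) _ _
            (x∈p∧x∉q⇒x∈p─q u∈ (∉-toSubset u∉)) (x∈p∧x∉q⇒x∈p─q v∈ (∉-toSubset v∉)))
      }

    -- `Bounded` only refutes larger sizes; since numbers are comparable, the inequality follows.
    size-≤ : ∣ S H ∣ ≤ β
    size-≤ = ≮⇒≥ λ β< → bounded-I linkedH (λ {x} _ → x) (members-unique (S H))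
      (All.tabulate (∈-members⁻ (S H))) (subst (β <_) (sym (length-members (S H))) β<)

realise : ∀ {k δ β r} (P : Piece k δ β r) → length (Piece.bs P) < k + k →
  Σ Graph λ G → (∀ v → δ ≤ deg G v) × (∃ λ v → deg G v ≤ r) ×
    (∀ (H : Subgraph G) → KConn k H → ∣ S H ∣ ≤ β)
realise P <2k with close P <2k
... | Q , bs≡[] = G , deg-≥ , (number (Piece.root Q) , root-deg-≤) , size-≤
  where open Realisation Q bs≡[]

-- Bags and patterns.

length-allFin : ∀ c → length (allFin c) ≡ c
length-allFin c = length-tabulate (λ i → i)

-- What remains of a level after cutting off both sides: the level (new), the set
-- below it (old), and the further vertex (core) of that set.
data Bag (c : ℕ) : Set where
  core    : Bag c
  new old : Fin c → Bag c

module _ {c : ℕ} (part : Fin c → ℕ) (κ : Fin c → Fin c → Set) where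

  BagAdj : Bag c → Bag c → Set
  BagAdj (new i) (new j) = κ i j
  BagAdj (old i) (old j) = part i ≡ part j × κ i j
  BagAdj _       _       = ⊤

-- The choices in which the two parts of the theorem differ: `part` assigns the thirds and `κ` is
-- adjacency within a level. `κ-degree` adds to the peers of a vertex the `c + 1` vertices of the
-- set below and the `c` vertices of the one later level joined to it. `late r` lists the vertices
-- whose later level is missing when only `r` levels follow.
record Pattern (k c δ β : ℕ) : Set₁ where
  field
    c<k      : c < k
    1≤β      : 1 ≤ β
    part     : Fin c → ℕ
    part≤2   : ∀ i → part i ≤ 2
    κ        : Fin c → Fin c → Set
    κ?       : ∀ i j → Dec (κ i j)
    κ-sym    : ∀ {i j} → κ i j → κ j i
    κ-irrefl : ∀ {i} → ¬ κ i i
    δ≤3c     : δ ≤ c + (c + c)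
    κ-degree : ∀ i → ∃ λ ns → Unique ns × All (κ i) ns × δ ≤ length ns + suc c + c
    late     : ℕ → List (Fin c)
    late⁺    : ∀ {r i} → r ≤ part i → i ∈ late r
    late⁻    : ∀ {r i} → i ∈ late r → r ≤ part i
    few-late : length (late 0) + (length (late 1) + length (late 2)) < k + k
    bag      : Bounded k β (BagAdj part κ) (λ _ → ⊤)

-- The tower of levels.

module Tower {k c δ β : ℕ} (pattern′ : Pattern k c δ β) where

  open Pattern pattern′

  Vertex : Set
  Vertex = ℕ ⊎ (ℕ × Fin c)

  -- cl n is the level Cₙ and lower n is Tₙ.  The vertices sp j start the tower: some of those with
  -- j > 0 stand in for the missing levels below C₀ in T₀, T₁, T₂, and each sp j is the further
  -- vertex of T₃ⱼ, T₃ⱼ₊₁ and T₃ⱼ₊₂, which is enough for its degree.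
  pattern sp j   = inj₁ j
  pattern cl n i = inj₂ (n , i)

  _≈?_ : (u v : Vertex) → Dec (u ≡ v)
  _≈?_ = Sum.≡-dec ℕ._≟_ (Product.≡-dec ℕ._≟_ Fin._≟_)

  open DecMembership _≈?_ using (_∈?_)

  -- Vertex `i` of a level enters the set belonging to the level `part i + 1` steps later, so
  -- position `i` for `n` comes from level `n - 1 - part i`. Where no such level exists, a start
  -- vertex stands in.
  slot : ℕ → Fin c → Vertex
  slot n i with n ≤? part i
  -- `n * c + toℕ i` differs for different pairs; the successor keeps clear of `sp 0`, the further
  -- vertex of the first three sets.
  ... | yes _ = sp (suc (n * c + toℕ i))
  ... | no _  = cl (n ∸ suc (part i)) i

  lower : ℕ → List Vertex
  lower n = sp (n / 3) ∷ map (slot n) (allFin c)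

  slot-cl : ∀ {n i m j} → slot n i ≡ cl m j → i ≡ j × n ≡ suc m + part j
  slot-cl {n} {i} e with n ≤? part i
  slot-cl {n} {i} refl | no n≰ = refl , trans (sym (m∸n+n≡m (≰⇒> n≰))) (+-suc _ _)

  slot-sp : ∀ {n i j} → slot n i ≡ sp j → n ≤ part i × j ≡ suc (n * c + toℕ i)
  slot-sp {n} {i} e with n ≤? part i
  slot-sp {n} {i} refl | yes n≤ = n≤ , refl

  slot-above : ∀ m i → slot (suc m + part i) i ≡ cl m i
  slot-above m i with suc m + part i ≤? part i
  ... | yes p = ⊥-elim (<⇒≱ (m<n+m (part i) (s≤s z≤n)) p)
  ... | no _  = cong (λ x → cl x i) (m+n∸n≡m m (part i))

  slot-injective : ∀ n {i j} → slot n i ≡ slot n j → i ≡ j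
  slot-injective n {i} {j} e with slot n j in eq
  ... | cl _ _ = trans (proj₁ (slot-cl e)) (sym (proj₁ (slot-cl {n} {j} eq)))
  ... | sp _ = toℕ-injective (+-cancelˡ-≡ (n * c) _ _
    (suc-injective (trans (sym (proj₂ (slot-sp {n} {i} e))) (proj₂ (slot-sp {n} {j} eq)))))

  n≤2⇒n/3≡0 : ∀ {n} → n ≤ 2 → n / 3 ≡ 0
  n≤2⇒n/3≡0 n≤2 = m<n⇒m/n≡0 (s≤s n≤2)

  -- Start vertices occur as slots only for `n` at most 2; there the further vertex is `sp 0`, while
  -- slots have positive numbers.
  slot≢core : ∀ {n i} → slot n i ≢ sp (n / 3)
  slot≢core {n} {i} e with slot-sp {n} {i} e
  ... | n≤ , e′ with trans (sym (n≤2⇒n/3≡0 (≤-trans n≤ (part≤2 i)))) e′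
  ...   | ()

  -- With `lower-cl⁺` this shows that a level vertex is joined to exactly one later level.
  lower-cl : ∀ {n m i} → cl m i ∈ lower n → n ≡ suc m + part i
  lower-cl {n} (there p) with ∈-map⁻ (slot n) p
  ... | i , _ , e = proj₂ (slot-cl {n} {i} (sym e))

  lower-cl< : ∀ {n m i} → cl m i ∈ lower n → m < n
  lower-cl< {m = m} {i} p = ≤-trans (m≤m+n (suc m) (part i)) (≤-reflexive (sym (lower-cl p)))

  lower-cl⁺ : ∀ m i → cl m i ∈ lower (suc m + part i)
  lower-cl⁺ m i = there (subst (_∈ map (slot (suc m + part i)) (allFin c)) (slot-above m i)
    (∈-map⁺ (slot (suc m + part i)) (∈-allFin i)))

  lower-sp : ∀ {n j} → sp j ∈ lower n → j ≡ n / 3 ⊎ ∃ λ i → n ≤ part i × j ≡ suc (n * c + toℕ i)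
  lower-sp (here refl) = inj₁ refl
  lower-sp {n} (there p) with ∈-map⁻ (slot n) p
  ... | i , _ , e = inj₂ (i , slot-sp {n} {i} (sym e))

  lower-unique : ∀ n → Unique (lower n)
  lower-unique n = All.map⁺ (All.tabulate λ {i} _ e → slot≢core {n} {i} (sym e)) ∷
    Unique.map⁺ (slot-injective n) (Unique.allFin⁺ c)

  length-lower : ∀ n → length (lower n) ≡ suc c
  length-lower n = cong suc (trans (length-map (slot n) (allFin c)) (length-allFin c))

  data Adj : Vertex → Vertex → Set where
    peer : ∀ {n i j} → κ i j → Adj (cl n i) (cl n j)
    up   : ∀ {v n i} → v ∈ lower n → Adj v (cl n i)
    down : ∀ {v n i} → v ∈ lower n → Adj (cl n i) v

  Adj-sym : ∀ {u v} → Adj u v → Adj v u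
  Adj-sym (peer κij) = peer (κ-sym κij)
  Adj-sym (up p)     = down p
  Adj-sym (down p)   = up p

  cl∉lower : ∀ {n i} → cl n i ∉ lower n
  cl∉lower p = <-irrefl refl (lower-cl< p)

  Adj-irrefl : ∀ {v} → ¬ Adj v v
  Adj-irrefl (peer κii) = κ-irrefl κii
  Adj-irrefl (up p)     = cl∉lower p
  Adj-irrefl (down p)   = cl∉lower p

  Adj? : ∀ u v → Dec (Adj u v)
  Adj? (sp j) (sp l) = no λ ()
  Adj? (sp j) (cl n i) = map′ up (λ { (up p) → p }) (sp j ∈? lower n)
  Adj? (cl n i) (sp j) = map′ down (λ { (down p) → p }) (sp j ∈? lower n)
  Adj? (cl m i) (cl n j) = map′ to from
    ((m ℕ.≟ n ×-dec κ? i j) ⊎-dec (cl m i ∈? lower n ⊎-dec cl n j ∈? lower m))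
    where
    to : _ → Adj (cl m i) (cl n j)
    to (inj₁ (refl , κij)) = peer κij
    to (inj₂ (inj₁ p))     = up p
    to (inj₂ (inj₂ p))     = down p
    from : Adj (cl m i) (cl n j) → _
    from (peer κij) = inj₁ (refl , κij)
    from (up p)     = inj₂ (inj₁ p)
    from (down p)   = inj₂ (inj₂ p)

  Below Level : ℕ → Vertex → Set
  Below n (sp _)   = ⊤
  Below n (cl m _) = m < n
  Level n (sp _)   = ⊥
  Level n (cl m _) = m ≡ n

  Below? : ∀ n v → Dec (Below n v)
  Below? n (sp _)   = yes tt
  Below? n (cl m _) = m <? n

  Level? : ∀ n v → Dec (Level n v)
  Level? n (sp _)   = no λ ()
  Level? n (cl m _) = m ℕ.≟ n

  lower-Below : ∀ {m n v} → m ≤ n → v ∈ lower m → Below n v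
  lower-Below {v = sp _}   _   _ = tt
  lower-Below {v = cl _ _} m≤n p = ≤-trans (lower-cl< p) m≤n

  place : ℕ → Bag c → Vertex
  place n core    = sp (n / 3)
  place n (new i) = cl n i
  place n (old i) = slot n i

  cl≢slot : ∀ {n i j} → cl n i ≢ slot n j
  cl≢slot {n} {i} {j} e with slot-cl {n} {j} (sym e)
  ... | _ , e′ = <-irrefl e′ (s≤s (m≤m+n n (part i)))

  place-injective : ∀ n {x y} → place n x ≡ place n y → x ≡ y
  place-injective n {core}  {core}  _    = refl
  place-injective n {core}  {old j} e    = ⊥-elim (slot≢core {n} {j} (sym e))
  place-injective n {new i} {new j} refl = refl
  place-injective n {new i} {old j} e    = ⊥-elim (cl≢slot {n} {i} {j} e)
  place-injective n {old i} {core}  e    = ⊥-elim (slot≢core {n} {i} e)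
  place-injective n {old i} {new j} e    = ⊥-elim (cl≢slot {n} {j} {i} (sym e))
  place-injective n {old i} {old j} e    = cong old (slot-injective n e)

  -- The sets for `n` equal to 1 or 2 mix start and level vertices and must still fall apart into
  -- thirds. A start vertex that is a slot for `n` has number above `n * c`, whereas those in the
  -- earlier set for `m` have number 0 or at most `(m + 1) * c`.
  sp-slot-independent : ∀ {n i j m} → n ≤ part i → n ≡ suc m + part j →
    sp (suc (n * c + toℕ i)) ∉ lower m
  sp-slot-independent {n} {i} {j} {m} n≤ n≡ p with lower-sp p
    | ≤-trans (m≤m+n (suc m) (part j)) (≤-reflexive (sym n≡))
  ... | inj₁ e | m<n with trans e (n≤2⇒n/3≡0 (≤-trans (<⇒≤ m<n) (≤-trans n≤ (part≤2 i))))
  ...   | ()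
  sp-slot-independent {n} {i} {j} {m} n≤ n≡ p | inj₂ (i′ , _ , e) | m<n = <-irrefl (sym (suc-injective e)) (begin-strict
    m * c + toℕ i′  <⟨ +-monoʳ-< (m * c) (toℕ<n i′) ⟩
    m * c + c       ≡⟨ +-comm (m * c) c ⟩
    suc m * c       ≤⟨ *-monoˡ-≤ c m<n ⟩
    n * c           ≤⟨ m≤m+n (n * c) (toℕ i) ⟩
    n * c + toℕ i   ∎)
    where open ≤-Reasoning

  -- Two slots on one level `m` both have part `n - 1 - m`. An edge between levels would place its
  -- lower end in the set of a level before `n`, although `lower-cl` allows it only in the set for
  -- `n`.
  slots-reflect : ∀ n {i j} {u v} → slot n i ≡ u → slot n j ≡ v → Adj u v → part i ≡ part j × κ i j
  slots-reflect n {i} {j} eu ev (peer {n = m} κij) with slot-cl {n} {i} eu | slot-cl {n} {j} ev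
  ... | refl , e | refl , e′ = +-cancelˡ-≡ (suc m) _ _ (trans (sym e) e′) , κij
  slots-reflect n {i} {j} {sp _} eu ev (up p) with slot-sp {n} {i} eu | slot-cl {n} {j} ev
  ... | n≤ , refl | refl , e′ = ⊥-elim (sp-slot-independent {j = j} n≤ e′ p)
  slots-reflect n {i} {j} {cl _ _} eu ev (up p) with slot-cl {n} {i} eu | slot-cl {n} {j} ev
  ... | refl , e | refl , e′ = ⊥-elim (<-irrefl (trans (lower-cl p) (sym e))
    (≤-trans (s≤s (m≤m+n _ (part j))) (≤-reflexive (sym e′))))
  slots-reflect n {i} {j} {v = sp _} eu ev (down p) with slot-cl {n} {i} eu | slot-sp {n} {j} ev
  ... | refl , e | n≤ , refl = ⊥-elim (sp-slot-independent {j = i} n≤ e p)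
  slots-reflect n {i} {j} {v = cl _ _} eu ev (down p) with slot-cl {n} {i} eu | slot-cl {n} {j} ev
  ... | refl , e | refl , e′ = ⊥-elim (<-irrefl (trans (lower-cl p) (sym e′))
    (≤-trans (s≤s (m≤m+n _ (part i))) (≤-reflexive (sym e))))

  place-reflects : ∀ n {x y} → Adj (place n x) (place n y) → BagAdj part κ x y
  place-reflects n {new i} {new j} (peer κij) = κij
  place-reflects n {new i} {new j} (up p)     = ⊥-elim (cl∉lower p)
  place-reflects n {new i} {new j} (down p)   = ⊥-elim (cl∉lower p)
  place-reflects n {old i} {old j} a          = slots-reflect n refl refl a
  place-reflects n {core}  {_}     _          = tt
  place-reflects n {new _} {core}  _          = tt
  place-reflects n {new _} {old _} _          = tt
  place-reflects n {old _} {core}  _          = tt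
  place-reflects n {old _} {new _} _          = tt

  bounded-bag : ∀ n → Bounded k β Adj (λ v → v ∈ lower n ⊎ Level n v)
  bounded-bag n = bounded-transfer (place n) (λ _ → yes tt)
    (λ _ _ → place-injective n) (λ {x} {y} _ _ → place-reflects n {x} {y}) onto bag
    where
    onto : ∀ {v} → v ∈ lower n ⊎ Level n v → ∃ λ x → ⊤ × place n x ≡ v
    onto (inj₁ (here refl)) = core , tt , refl
    onto (inj₁ (there p)) with ∈-map⁻ (slot n) p
    ... | i , _ , refl = old i , tt , refl
    onto {cl _ i} (inj₂ refl) = new i , tt , refl

  -- Induction on the height: the `c + 1` vertices of `lower n` separate level `n` from everything
  -- before it. At height 0 only the pairwise non-adjacent start vertices are left.
  bounded-below : ∀ n → Bounded k β Adj (Below n)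
  bounded-below zero = bounded-independent k β Adj 1≤β independent
    where
    independent : ∀ {u v} → Below 0 u → Below 0 v → ¬ Adj u v
    independent {sp _} {sp _} _ _ ()
  bounded-below (suc n) = bounded-split k β Adj (Below? n)
    (λ v → (v ∈? lower n) ⊎-dec Level? n v) cover sides
    (lower n) (≤-trans (≤-reflexive (length-lower n)) c<k) shared
    (bounded-⊆ k β Adj proj₂ (bounded-below n)) (bounded-⊆ k β Adj proj₂ (bounded-bag n))
    where
    Above : Vertex → Set
    Above v = v ∈ lower n ⊎ Level n v

    cover : ∀ {v} → Below (suc n) v → Below n v ⊎ Above v
    cover {sp _}   _ = inj₁ tt
    cover {cl m _} m< with m≤n⇒m<n∨m≡n (≤-pred m<)
    ... | inj₁ m<n = inj₁ m<n
    ... | inj₂ m≡n = inj₂ (inj₂ m≡n)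

    shared : ∀ {v} → Below (suc n) v → Below n v → Above v → v ∈ lower n
    shared _ _ (inj₁ p) = p
    shared {cl _ _} _ m<n (inj₂ refl) = ⊥-elim (<-irrefl refl m<n)

    sides : ∀ {u v} → Below (suc n) u → Below (suc n) v → Adj u v →
      (Below n u × Below n v) ⊎ (Above u × Above v)
    sides {cl m _} b _ (peer _) with m≤n⇒m<n∨m≡n (≤-pred b)
    ... | inj₁ m<n = inj₁ (m<n , m<n)
    ... | inj₂ m≡n = inj₂ (inj₂ m≡n , inj₂ m≡n)
    sides {v = cl m _} _ b (up p) with m≤n⇒m<n∨m≡n (≤-pred b)
    ... | inj₁ m<n  = inj₁ (lower-Below (<⇒≤ m<n) p , m<n)
    ... | inj₂ refl = inj₂ (inj₁ p , inj₂ refl)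
    sides {cl m _} b _ (down p) with m≤n⇒m<n∨m≡n (≤-pred b)
    ... | inj₁ m<n  = inj₁ (m<n , lower-Below (<⇒≤ m<n) p)
    ... | inj₂ refl = inj₂ (inj₂ refl , inj₁ p)

  -- `M` is `3 * (3c + 1)`: stand-ins have numbers up to `3c`, and each of the `3c + 1` start
  -- vertices is to be the further vertex for three levels below `M`.
  L M : ℕ
  L = 3 * c * 3
  M = 3 + L

  vs : List Vertex
  vs = map inj₁ (upTo (suc (3 * c))) ++ map inj₂ (cartesianProduct (upTo M) (allFin c))

  vs-unique : Unique vs
  vs-unique = Unique.++⁺ (Unique.map⁺ inj₁-injective (Unique.upTo⁺ _))
    (Unique.map⁺ inj₂-injective (Unique.cartesianProduct⁺ (Unique.upTo⁺ M) (Unique.allFin⁺ c))) map-disjoint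

  sp∈ : ∀ {j} → j < suc (3 * c) → sp j ∈ vs
  sp∈ j< = ∈-++⁺ˡ (∈-map⁺ inj₁ (∈-upTo⁺ j<))

  sp∈⁻ : ∀ {j} → sp j ∈ vs → j < suc (3 * c)
  sp∈⁻ = ∈-upTo⁻ ∘ inj₁-∈

  cl∈ : ∀ {n i} → n < M → cl n i ∈ vs
  cl∈ {i = i} n< = ∈-++⁺ʳ _ (∈-map⁺ inj₂ (∈-cartesianProduct⁺ (∈-upTo⁺ n<) (∈-allFin i)))

  cl∈⁻ : ∀ {n i} → cl n i ∈ vs → n < M
  cl∈⁻ p = ∈-upTo⁻ (proj₁ (∈-cartesianProduct⁻ (upTo M) (allFin c) (inj₂-∈ {as = upTo (suc (3 * c))} p)))

  vs⊆Below : ∀ {v} → v ∈ vs → Below M v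
  vs⊆Below {sp _}   _ = tt
  vs⊆Below {cl _ _} p = cl∈⁻ p

  lower⊆vs : ∀ {n v} → n < M → v ∈ lower n → v ∈ vs
  lower⊆vs {v = cl _ _} n<M p = cl∈ (<-trans (lower-cl< p) n<M)
  lower⊆vs {n} {sp _} n<M p with lower-sp p
  ... | inj₁ refl = sp∈ (m<n*o⇒m/o<n {n} {suc (3 * c)} {3} n<M)
  ... | inj₂ (i , n≤ , refl) = sp∈ (s≤s (begin-strict
    n * c + toℕ i  <⟨ +-monoʳ-< (n * c) (toℕ<n i) ⟩
    n * c + c      ≡⟨ +-comm (n * c) c ⟩
    suc n * c      ≤⟨ *-monoˡ-≤ c (s≤s (≤-trans n≤ (part≤2 i))) ⟩
    3 * c          ∎))
    where open ≤-Reasoning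

  level : ℕ → List Vertex
  level n = map (cl′ n) (allFin c)
    where
    cl′ : ℕ → Fin c → Vertex
    cl′ n i = cl n i

  level⁺ : ∀ {n i} → cl n i ∈ level n
  level⁺ {n} {i} = ∈-map⁺ (λ j → cl n j) (∈-allFin i)

  level⁻ : ∀ {n v} → v ∈ level n → ∃ λ i → v ≡ cl n i
  level⁻ {n} p with ∈-map⁻ (λ j → cl n j) p
  ... | i , _ , e = i , e

  cl-injective : ∀ {n i j} → _≡_ {A = Vertex} (cl n i) (cl n j) → i ≡ j
  cl-injective refl = refl

  level-unique : ∀ n → Unique (level n)
  level-unique n = Unique.map⁺ cl-injective (Unique.allFin⁺ c)

  length-level : ∀ n → length (level n) ≡ c
  length-level n = trans (length-map _ (allFin c)) (length-allFin c)

  three-levels : ℕ → List Vertex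
  three-levels n = level n ++ level (1 + n) ++ level (2 + n)

  length-three-levels : ∀ n → length (three-levels n) ≡ c + (c + c)
  length-three-levels n = trans (length-++ (level n)) (cong₂ _+_ (length-level n)
    (trans (length-++ (level (1 + n))) (cong₂ _+_ (length-level (1 + n)) (length-level (2 + n)))))

  levels-disjoint : ∀ {m n} → m < n → ∀ {v} → ¬ (v ∈ level m × v ∈ level n)
  levels-disjoint m<n (p , q) with level⁻ p | level⁻ q
  ... | _ , refl | _ , refl = <-irrefl refl m<n

  three-levels-unique : ∀ n → Unique (three-levels n)
  three-levels-unique n = Unique.++⁺ (level-unique n)
    (Unique.++⁺ (level-unique (1 + n)) (level-unique (2 + n)) (levels-disjoint ≤-refl)) disjoint
    where
    disjoint : ∀ {v} → ¬ (v ∈ level n × v ∈ level (1 + n) ++ level (2 + n))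
    disjoint (p , q) with ∈-++⁻ (level (1 + n)) q
    ... | inj₁ q₁ = levels-disjoint ≤-refl (p , q₁)
    ... | inj₂ q₂ = levels-disjoint (m<n+m n (s≤s z≤n)) (p , q₂)

  sp-degree : ∀ {j} → sp j ∈ vs → HasDegree Adj vs δ (sp j)
  sp-degree {j} j∈ = three-levels (j * 3) ,
    ( three-levels-unique (j * 3)
    , All.++⁺ (nbrs 0 z≤n) (All.++⁺ (nbrs 1 (s≤s z≤n)) (nbrs 2 ≤-refl)) ) ,
    ≤-trans δ≤3c (≤-reflexive (sym (length-three-levels (j * 3))))
    where
    quotient : ∀ {r} → r ≤ 2 → (r + j * 3) / 3 ≡ j
    quotient {r} r≤2 = ≤-antisym
      (≤-pred (m<n*o⇒m/o<n {r + j * 3} {suc j} {3} (+-monoˡ-≤ (j * 3) (s≤s r≤2))))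
      (≤-trans (≤-reflexive (sym (m*n/n≡m j 3))) (/-monoˡ-≤ 3 (m≤n+m (j * 3) r)))
    nbrs : ∀ r → r ≤ 2 → All (λ w → w ∈ vs × Adj (sp j) w) (level (r + j * 3))
    nbrs r r≤2 = All.tabulate λ p → good (level⁻ p)
      where
      good : ∀ {w} → (∃ λ i → w ≡ cl (r + j * 3) i) → w ∈ vs × Adj (sp j) w
      good (i , refl) =
        cl∈ (≤-trans (+-monoˡ-≤ (j * 3) (s≤s r≤2)) (*-monoˡ-≤ 3 (sp∈⁻ j∈))) ,
        up (subst (λ x → sp x ∈ lower (r + j * 3)) (quotient r≤2) (here refl))

  -- The last three levels, from the top down: a vertex is deficient when at most `part i` levels
  -- follow its own.
  bs : List Vertex
  bs = map (λ i → cl (2 + L) i) (late 0) ++ map (λ i → cl (1 + L) i) (late 1) ++ map (λ i → cl L i) (late 2)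

  length-bs : length bs < k + k
  length-bs = ≤-trans (s≤s (≤-reflexive (trans (length-++ (map _ (late 0))) (cong₂ _+_ (length-map _ (late 0))
    (trans (length-++ (map _ (late 1))) (cong₂ _+_ (length-map _ (late 1)) (length-map _ (late 2)))))))) few-late

  bs⁻ : ∀ {v} → v ∈ bs → ∃ λ m → ∃ λ i → v ≡ cl m i × M ≤ suc m + part i
  bs⁻ p with ∈-++⁻ (map _ (late 0)) p
  ... | inj₁ q with ∈-map⁻ _ q
  ...   | i , _ , refl = 2 + L , i , refl , m≤m+n M (part i)
  bs⁻ p | inj₂ p′ with ∈-++⁻ (map _ (late 1)) p′
  ... | inj₁ q with ∈-map⁻ _ q
  ...   | i , i∈ , refl = 1 + L , i , refl , ≤-trans (≤-reflexive (+-comm 1 (2 + L))) (+-monoʳ-≤ (2 + L) (late⁻ i∈))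
  bs⁻ p | inj₂ p′ | inj₂ q with ∈-map⁻ _ q
  ...   | i , i∈ , refl = L , i , refl , ≤-trans (≤-reflexive (+-comm 2 (1 + L))) (+-monoʳ-≤ (1 + L) (late⁻ i∈))

  bs⁺ : ∀ {m i} → m < M → M ≤ suc m + part i → cl m i ∈ bs
  bs⁺ {m} {i} m<M M≤ with m≤n⇒m<n∨m≡n (≤-pred m<M)
  ... | inj₂ refl = ∈-++⁺ˡ (∈-map⁺ _ (late⁺ z≤n))
  ... | inj₁ m<2 with m≤n⇒m<n∨m≡n (≤-pred m<2)
  ...   | inj₂ refl = ∈-++⁺ʳ (map _ (late 0)) (∈-++⁺ˡ (∈-map⁺ _ (late⁺
    (+-cancelˡ-≤ (2 + L) _ _ (≤-trans (≤-reflexive (+-comm (2 + L) 1)) M≤)))))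
  ...   | inj₁ m<1 with m≤n⇒m<n∨m≡n (≤-pred m<1)
  ...     | inj₂ refl = ∈-++⁺ʳ (map _ (late 0)) (∈-++⁺ʳ (map _ (late 1)) (∈-map⁺ _ (late⁺
    (+-cancelˡ-≤ (1 + L) _ _ (≤-trans (≤-reflexive (+-comm (1 + L) 2)) M≤)))))
  -- Below level `L` the later level `m + 1 + part i` is at most `L + 2`, so it exists.
  ...     | inj₁ m<L = ⊥-elim (<⇒≱ (≤-trans (s≤s (+-mono-≤ m<L (part≤2 i))) (≤-reflexive (cong suc (+-comm L 2)))) M≤)

  -- A level vertex in this set has level `n` as its later level, so nothing is missing for it.
  -- Hence the whole set counts twice in `HalfDegree`.
  lower∩bs : ∀ {n v} → n < M → v ∈ lower n → v ∉ bs
  lower∩bs n<M p b with bs⁻ b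
  ... | m , i , refl , M≤ = <⇒≱ n<M (≤-trans M≤ (≤-reflexive (sym (lower-cl p))))

  sp∉bs : ∀ {j} → sp j ∉ bs
  sp∉bs b with bs⁻ b
  ... | _ , _ , () , _

  module _ {n : ℕ} {i : Fin c} (n<M : n < M) where

    peers : List Vertex
    peers = map (λ j → cl n j) (proj₁ (κ-degree i))

    length-peers : length peers ≡ length (proj₁ (κ-degree i))
    length-peers = length-map _ (proj₁ (κ-degree i))

    down-peers : Nbrs Adj vs (cl n i) (lower n ++ peers)
    down-peers with κ-degree i
    ... | js , js-unique , κ-js , _ =
      Unique.++⁺ (lower-unique n) (Unique.map⁺ cl-injective js-unique) disjoint ,
      All.++⁺ (All.tabulate λ p → lower⊆vs n<M p , down p)
        (All.map⁺ (All.map (λ κij → cl∈ n<M , peer κij) κ-js))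
      where
      disjoint : ∀ {v} → ¬ (v ∈ lower n × v ∈ map (λ j → cl n j) js)
      disjoint (p , q) with ∈-map⁻ _ q
      ... | _ , _ , refl = cl∉lower p

    length-down-peers : length (lower n ++ peers) ≡ suc c + length (proj₁ (κ-degree i))
    length-down-peers = trans (length-++ (lower n)) (cong₂ _+_ (length-lower n) length-peers)

    δ≤down-peers : δ ≤ length (lower n ++ peers) + c
    δ≤down-peers = ≤-trans (proj₂ (proj₂ (proj₂ (κ-degree i))))
      (≤-reflexive (cong (_+ c) (trans (+-comm _ (suc c)) (sym length-down-peers))))

    next : ℕ
    next = suc n + part i

    inner-degree : next < M → HasDegree Adj vs δ (cl n i)
    inner-degree next<M = (lower n ++ peers) ++ level next ,
      ( Unique.++⁺ (proj₁ down-peers) (level-unique next) disjoint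
      , All.++⁺ (proj₂ down-peers) (All.tabulate (ups ∘ level⁻)) ) ,
      ≤-trans δ≤down-peers (≤-reflexive (sym (trans (length-++ (lower n ++ peers)) (cong (length (lower n ++ peers) +_) (length-level next)))))
      where
      n<next : n < next
      n<next = m≤m+n (suc n) (part i)
      ups : ∀ {w} → (∃ λ j → w ≡ cl next j) → w ∈ vs × Adj (cl n i) w
      ups (j , refl) = cl∈ next<M , up (lower-cl⁺ n i)
      disjoint : ∀ {v} → ¬ (v ∈ lower n ++ peers × v ∈ level next)
      disjoint (p , q) with level⁻ q
      ... | _ , refl with ∈-++⁻ (lower n) p
      ...   | inj₁ p₁ = <-asym n<next (lower-cl< p₁)
      ...   | inj₂ p₂ with ∈-map⁻ (λ j → cl n j) p₂
      ...     | _ , _ , e = <-irrefl (sym (cong proj₁ (inj₂-injective e))) n<next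

    -- Doubling the `c + 1` neighbours below makes up for the `c` missing neighbours above.
    outer-degree : HalfDegree Adj vs δ bs (cl n i)
    outer-degree = lower n , peers , down-peers , All.tabulate (lower∩bs n<M) ,
      ≤-trans δ≤down-peers (+-monoʳ-≤ _ (≤-trans (n≤1+n c) (≤-reflexive (sym (length-lower n)))))

  degrees : ∀ {v} → v ∈ vs → HasDegree Adj vs δ v ⊎ (v ∈ bs × HalfDegree Adj vs δ bs v)
  degrees {sp j}   v∈ = inj₁ (sp-degree v∈)
  degrees {cl n i} v∈ with cl∈⁻ v∈ | suc n + part i <? M
  ... | n<M | yes next<M = inj₁ (inner-degree n<M next<M)
  ... | n<M | no  next≮M = inj₂ (bs⁺ n<M (≮⇒≥ next≮M) , outer-degree n<M)

  -- Stand-ins have positive numbers, so `sp 0` occurs only as a further vertex, and `n / 3 = 0`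
  -- leaves three levels. As the root it attains the minimum degree `3c` of the first part.
  star-complete : ∀ {w} → w ∈ vs → Adj (sp 0) w → w ∈ three-levels 0
  star-complete {cl n i} _ (up p) with lower-sp p
  ... | inj₁ 0≡ = low n n<3
    where
    n<3 : n < 3
    n<3 with n <? 3
    ... | yes n<3 = n<3
    ... | no n≮3  = ⊥-elim (<⇒≱ (/-monoˡ-≤ 3 (≮⇒≥ n≮3)) (≤-reflexive (sym 0≡)))
    low : ∀ n → n < 3 → cl n i ∈ three-levels 0
    low 0 _ = ∈-++⁺ˡ level⁺
    low 1 _ = ∈-++⁺ʳ (level 0) (∈-++⁺ˡ level⁺)
    low 2 _ = ∈-++⁺ʳ (level 0) (∈-++⁺ʳ (level 1) level⁺)
    low (suc (suc (suc _))) (s≤s (s≤s (s≤s ())))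

  piece : Piece k δ β (c + (c + c))
  piece = record
    { V = Vertex ; _≈?_ = _≈?_ ; Adj = Adj ; Adj? = Adj? ; Adj-sym = Adj-sym ; Adj-irrefl = Adj-irrefl
    ; vs = vs ; vs-unique = vs-unique
    ; bounded = bounded-⊆ k β Adj vs⊆Below (bounded-below M)
    ; bs = bs ; degrees = degrees
    ; root = sp 0 ; root∈vs = sp∈ (s≤s z≤n) ; root∉bs = sp∉bs
    ; rootNbrs = three-levels 0 ; root-complete = star-complete
    ; root-degree = ≤-reflexive (length-three-levels 0)
    }

-- Counting indices.

interval-length : ∀ {c a b} {xs : List (Fin c)} → Unique xs →
  All (λ i → a ≤ toℕ i × toℕ i < a + b) xs → length xs ≤ b
interval-length {a = a} {b} {xs} uxs within = begin
  length xs                ≡⟨ length-map toℕ xs ⟨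
  length (map toℕ xs)      ≤⟨ length-⊆ (Unique.map⁺ toℕ-injective uxs) shifted ⟩
  length (map (a +_) (upTo b)) ≡⟨ length-map (a +_) (upTo b) ⟩
  length (upTo b)          ≡⟨ length-upTo b ⟩
  b                        ∎
  where
  open ≤-Reasoning
  shifted : ∀ {m} → m ∈ map toℕ xs → m ∈ map (a +_) (upTo b)
  shifted m∈ with ∈-map⁻ toℕ m∈
  ... | i , i∈ , refl with All.lookup within i∈
  ...   | a≤ , <a+b = subst (_∈ map (a +_) (upTo b)) (m+[n∸m]≡n a≤)
    (∈-map⁺ (a +_) (∈-upTo⁺ (+-cancelˡ-< a _ _ (≤-trans (s≤s (≤-reflexive (m+[n∸m]≡n a≤))) <a+b))))

select : ∀ {c} {P : Fin c → Set} → (∀ i → Dec (P i)) → List (Fin c)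
select {c} P? = filter P? (allFin c)

select-interval : ∀ {c} a b {P : Fin c → Set} (P? : ∀ i → Dec (P i)) →
  (∀ {i} → P i → a ≤ toℕ i × toℕ i < a + b) → length (select P?) ≤ b
select-interval {c} a b P? within = interval-length (Unique.filter⁺ P? (Unique.allFin⁺ c))
  (All.map within (all-filter P? (allFin c)))

length-select+ : ∀ {c} {P : Fin c → Set} (P? : ∀ i → Dec (P i)) (rest : List (Fin c)) →
  (∀ i → ¬ P i → i ∈ rest) → c ≤ length (select P?) + length rest
length-select+ {c} P? rest other = begin
  c                                      ≡⟨ length-allFin c ⟨
  length (allFin c)                      ≤⟨ length-⊆ (Unique.allFin⁺ c) all⊆ ⟩
  length (select P? ++ rest)             ≡⟨ length-++ (select P?) ⟩
  length (select P?) + length rest       ∎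
  where
  open ≤-Reasoning
  all⊆ : ∀ {i} → i ∈ allFin c → i ∈ select P? ++ rest
  all⊆ {i} _ with P? i
  ... | yes p = ∈-++⁺ˡ (∈-filter⁺ P? (∈-allFin i) p)
  ... | no ¬p = ∈-++⁺ʳ (select P?) (other i ¬p)

-- Cutting a bag into thirds.

module _ {c : ℕ} (part : Fin c → ℕ) where

  InPart : ℕ → Bag c → Set
  InPart s (old i) = part i ≡ s
  InPart s _       = ⊤

  OffPart : ℕ → Bag c → Set
  OffPart s (old i) = part i ≢ s
  OffPart s _       = ⊤

middle : ∀ {c} → List (Bag c)
middle {c} = core ∷ map new (allFin c)

length-middle : ∀ {c} → length (middle {c}) ≡ suc c
length-middle {c} = cong suc (trans (length-map new (allFin c)) (length-allFin c))

module _ {k c β : ℕ} (c<k : c < k) (part : Fin c → ℕ) (part≤2 : ∀ i → part i ≤ 2)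
         (κ : Fin c → Fin c → Set) where

  private
    In Off : ℕ → Bag c → Set
    In  = InPart part
    Off = OffPart part

  -- Old vertices of different parts are not adjacent, so the `c + 1` vertices of `middle` separate
  -- the third `s` from the others.
  bounded-part : ∀ s {P : Bag c → Set} → Bounded k β (BagAdj part κ) (In s) →
    Bounded k β (BagAdj part κ) (λ x → P x × Off s x) → Bounded k β (BagAdj part κ) P
  bounded-part s {P} bIn bOff = bounded-split k β (BagAdj part κ) in? off? (λ {x} _ → cover x) (λ {x} {y} _ _ → sides x y)
    middle (≤-trans (≤-reflexive length-middle) c<k) (λ {x} _ → shared x) (bounded-⊆ k β _ proj₂ bIn) bOff
    where
    in? : ∀ x → Dec (In s x)
    in? core    = yes tt
    in? (new _) = yes tt
    in? (old i) = part i ℕ.≟ s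

    off? : ∀ x → Dec (Off s x)
    off? core    = yes tt
    off? (new _) = yes tt
    off? (old i) = ¬? (part i ℕ.≟ s)

    cover : ∀ x → In s x ⊎ Off s x
    cover core    = inj₁ tt
    cover (new _) = inj₁ tt
    cover (old i) with part i ℕ.≟ s
    ... | yes p = inj₁ p
    ... | no ¬p = inj₂ ¬p

    shared : ∀ x → In s x → Off s x → x ∈ middle
    shared core    _ _ = here refl
    shared (new i) _ _ = there (∈-map⁺ new (∈-allFin i))
    shared (old _) p ¬p = ⊥-elim (¬p p)

    sides : ∀ x y → BagAdj part κ x y → (In s x × In s y) ⊎ (Off s x × Off s y)
    sides (old i) (old j) (e , _) with part i ℕ.≟ s
    ... | yes p = inj₁ (p , trans (sym e) p)
    ... | no ¬p = inj₂ (¬p , ¬p ∘ trans e)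
    sides core    y _ with cover y
    ... | inj₁ p = inj₁ (tt , p)
    ... | inj₂ p = inj₂ (tt , p)
    sides (new _) y _ with cover y
    ... | inj₁ p = inj₁ (tt , p)
    ... | inj₂ p = inj₂ (tt , p)
    sides (old i) core _ with cover (old i)
    ... | inj₁ p = inj₁ (p , tt)
    ... | inj₂ p = inj₂ (p , tt)
    sides (old i) (new _) _ with cover (old i)
    ... | inj₁ p = inj₁ (p , tt)
    ... | inj₂ p = inj₂ (p , tt)

  bounded-parts : (∀ (s : Fin 3) → Bounded k β (BagAdj part κ) (In (toℕ s))) →
    Bounded k β (BagAdj part κ) (λ _ → ⊤)
  bounded-parts b = bounded-part 0 (b zero) (bounded-part 1 (b (suc zero))
    (bounded-⊆ k β _ (λ {x} p → last x (proj₂ (proj₁ p)) (proj₂ p)) (b (suc (suc zero)))))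
    where
    last : ∀ x → Off 0 x → Off 1 x → In 2 x
    last core    _ _ = tt
    last (new _) _ _ = tt
    last (old i) ≢0 ≢1 = ≤-antisym (part≤2 i) (≤∧≢⇒< (n≢0⇒n>0 ≢0) (≢1 ∘ sym))

-- First part: complete levels.

module Thirds (p₀ p₁ p₂ β : ℕ) (p₂≤p₁ : p₂ ≤ p₁) (p₁≤p₀ : p₁ ≤ p₀)
              (fits : suc (p₀ + p₁ + p₂) + p₀ ≤ β) where

  c k : ℕ
  c = p₀ + p₁ + p₂
  k = suc c

  part : Fin c → ℕ
  part i with toℕ i <? p₀ | toℕ i <? p₀ + p₁
  ... | yes _ | _     = 0
  ... | no _  | yes _ = 1
  ... | no _  | no _  = 2

  part≤2 : ∀ i → part i ≤ 2
  part≤2 i with toℕ i <? p₀ | toℕ i <? p₀ + p₁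
  ... | yes _ | _     = z≤n
  ... | no _  | yes _ = s≤s z≤n
  ... | no _  | no _  = ≤-refl

  part₀ : ∀ {i} → part i ≡ 0 → toℕ i < p₀
  part₀ {i} e with toℕ i <? p₀ | toℕ i <? p₀ + p₁
  ... | yes p | _ = p
  part₀ () | no _ | yes _
  part₀ () | no _ | no _

  part₁ : ∀ {i} → part i ≡ 1 → toℕ i < p₀ + p₁
  part₁ {i} e with toℕ i <? p₀ | toℕ i <? p₀ + p₁
  part₁ () | yes _ | _
  ... | no _ | yes p = p
  part₁ () | no _ | no _

  1≤part : ∀ {i} → 1 ≤ part i → p₀ ≤ toℕ i
  1≤part {i} 1≤ with toℕ i <? p₀ | toℕ i <? p₀ + p₁
  1≤part () | yes _ | _
  ... | no ≮ | _ = ≮⇒≥ ≮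

  2≤part : ∀ {i} → 2 ≤ part i → p₀ + p₁ ≤ toℕ i
  2≤part {i} 2≤ with toℕ i <? p₀ | toℕ i <? p₀ + p₁
  2≤part () | yes _ | _
  2≤part (s≤s ()) | no _ | yes _
  ... | no _ | no ≮ = ≮⇒≥ ≮

  late : ℕ → List (Fin c)
  late r = select (λ i → r ≤? part i)

  length-part : ∀ (s : Fin 3) → length (select (λ i → part i ℕ.≟ toℕ s)) ≤ p₀
  length-part zero = select-interval 0 p₀ (λ i → part i ℕ.≟ 0) (λ e → z≤n , part₀ e)
  length-part (suc zero) = ≤-trans
    (select-interval p₀ p₁ (λ i → part i ℕ.≟ 1) (λ e → 1≤part (≤-reflexive (sym e)) , part₁ e)) p₁≤p₀
  length-part (suc (suc zero)) = ≤-trans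
    (select-interval (p₀ + p₁) p₂ (λ i → part i ℕ.≟ 2) (λ {i} e → 2≤part (≤-reflexive (sym e)) , toℕ<n i))
    (≤-trans p₂≤p₁ p₁≤p₀)

  -- The three lists have at most `c`, `p₁ + p₂` and `p₂` entries. As the thirds decrease in size,
  -- `p₁ + p₂ + p₂` is at most `c`, so the total is at most `2c`.
  few-late : length (late 0) + (length (late 1) + length (late 2)) < k + k
  few-late = s≤s (begin
    length (late 0) + (length (late 1) + length (late 2))
      ≤⟨ +-mono-≤ (select-interval 0 c (λ i → 0 ≤? part i) (λ {i} _ → z≤n , toℕ<n i)) (+-mono-≤
           (select-interval p₀ (p₁ + p₂) (λ i → 1 ≤? part i)
             (λ {i} p → 1≤part p , ≤-trans (toℕ<n i) (≤-reflexive (+-assoc p₀ p₁ p₂))))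
           (select-interval (p₀ + p₁) p₂ (λ i → 2 ≤? part i) (λ {i} p → 2≤part p , toℕ<n i))) ⟩
    c + (p₁ + p₂ + p₂)
      ≤⟨ +-monoʳ-≤ c (+-monoˡ-≤ p₂ (+-mono-≤ p₁≤p₀ p₂≤p₁)) ⟩
    c + (p₀ + p₁ + p₂)
      ≤⟨ +-monoʳ-≤ c (n≤1+n c) ⟩
    c + k ∎)
    where open ≤-Reasoning

  degree : ∀ (i : Fin c) → ∃ λ ns → Unique ns × All (i ≢_) ns × c + (c + c) ≤ length ns + suc c + c
  degree i = select i≢? , Unique.filter⁺ i≢? (Unique.allFin⁺ c) , all-filter i≢? (allFin c) , (begin
    c + (c + c)                        ≤⟨ +-monoˡ-≤ (c + c) (length-select+ i≢? (i ∷ []) rest) ⟩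
    length (select i≢?) + 1 + (c + c)  ≡⟨ solve 2 (λ n c → n :+ con 1 :+ (c :+ c) := n :+ (con 1 :+ c) :+ c) refl (length (select i≢?)) c ⟩
    length (select i≢?) + suc c + c    ∎)
    where
    open ≤-Reasoning
    open +-*-Solver
    i≢? : ∀ j → Dec (i ≢ j)
    i≢? j = ¬? (i Fin.≟ j)
    rest : ∀ j → ¬ (i ≢ j) → j ∈ i ∷ []
    rest j ¬≢ = here (sym (decidable-stable (i Fin.≟ j) ¬≢))

  -- The level, the further vertex and one third make at most `c + 1 + p₀` vertices, which `fits`
  -- compares with `β`.
  bag : ∀ s → Bounded k β (BagAdj part _≢_) (InPart part (toℕ s))
  bag s = bounded-list k β _ (core ∷ map new (allFin c) ++ map old (select in?)) size cover
    where
    in? : ∀ i → Dec (part i ≡ toℕ s)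
    in? i = part i ℕ.≟ toℕ s
    size : suc (length (map new (allFin c) ++ map old (select in?))) ≤ β
    size = ≤-trans (s≤s (≤-trans (≤-reflexive (trans (length-++ (map new (allFin c)))
      (cong₂ _+_ (trans (length-map new (allFin c)) (length-allFin c)) (length-map old (select in?)))))
      (+-monoʳ-≤ c (length-part s)))) fits
    cover : ∀ {x} → InPart part (toℕ s) x → x ∈ core ∷ map new (allFin c) ++ map old (select in?)
    cover {core}  _ = here refl
    cover {new i} _ = there (∈-++⁺ˡ (∈-map⁺ new (∈-allFin i)))
    cover {old i} p = there (∈-++⁺ʳ (map new (allFin c)) (∈-map⁺ old (∈-filter⁺ in? (∈-allFin i) p)))

  pattern₃ : Pattern k c (c + (c + c)) β
  pattern₃ = record
    { c<k = ≤-refl ; 1≤β = ≤-trans (s≤s z≤n) fits ; part = part ; part≤2 = part≤2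
    ; κ = _≢_ ; κ? = λ i j → ¬? (i Fin.≟ j) ; κ-sym = λ i≢j → i≢j ∘ sym ; κ-irrefl = λ i≢i → i≢i refl
    ; δ≤3c = ≤-refl ; κ-degree = degree
    ; late = late ; late⁺ = λ {r} {i} r≤ → ∈-filter⁺ (λ i → r ≤? part i) (∈-allFin i) r≤
    ; late⁻ = λ {r} i∈ → proj₂ (∈-filter⁻ (λ i → r ≤? part i) {xs = allFin c} i∈)
    ; few-late = few-late
    ; bag = bounded-parts ≤-refl part part≤2 _≢_ bag
    }

-- Second part: thirds split into halves.

module HalvedThirds (q k : ℕ) (c<k : 3 * (2 * q) < k) where

  c : ℕ
  c = 3 * (2 * q)

  third : Fin c → Fin 3
  third i = proj₁ (remQuot (2 * q) i)

  within : Fin c → Fin (2 * q)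
  within i = proj₂ (remQuot {3} (2 * q) i)

  half : Fin c → Fin 2
  half i = proj₁ (remQuot {2} q (within i))

  unsplit : ∀ i → combine (third i) (within i) ≡ i
  unsplit i = combine-remQuot {3} (2 * q) i

  third-combine : ∀ (t : Fin 3) (j : Fin (2 * q)) → third (combine t j) ≡ t
  third-combine t j = cong proj₁ (remQuot-combine t j)

  within-combine : ∀ (t : Fin 3) (j : Fin (2 * q)) → within (combine t j) ≡ j
  within-combine t j = cong proj₂ (remQuot-combine t j)

  cell : Fin 3 → Fin 2 → List (Fin c)
  cell t h = map (λ j → combine t (combine h j)) (allFin q)

  ∈-cell : ∀ {i t h} → third i ≡ t → half i ≡ h → i ∈ cell t h
  ∈-cell {i} refl refl = subst (_∈ cell (third i) (half i))
    (trans (cong (combine (third i)) (combine-remQuot {2} q (within i))) (unsplit i))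
    (∈-map⁺ _ (∈-allFin (proj₂ (remQuot {2} q (within i)))))

  length-cell : ∀ t h → length (cell t h) ≡ q
  length-cell t h = trans (length-map _ (allFin q)) (length-allFin q)

  part : Fin c → ℕ
  part i = toℕ (third i)

  part≤2 : ∀ i → part i ≤ 2
  part≤2 i = ≤-pred (toℕ<n (third i))

  -- The complement of three disjoint complete bipartite graphs with sides of size `q`.
  κ : Fin c → Fin c → Set
  κ i j = i ≢ j × ¬ (third i ≡ third j × half i ≢ half j)

  κ? : ∀ i j → Dec (κ i j)
  κ? i j = ¬? (i Fin.≟ j) ×-dec ¬? ((third i Fin.≟ third j) ×-dec ¬? (half i Fin.≟ half j))

  κ-half : ∀ {i j} → κ i j → third i ≡ third j → half i ≡ half j
  κ-half {i} {j} (_ , ¬h) t = decidable-stable (half i Fin.≟ half j) λ ≢h → ¬h (t , ≢h)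

  ≢⇒opposite : ∀ {h h′ : Fin 2} → h ≢ h′ → h′ ≡ opposite h
  ≢⇒opposite {zero}     {zero}     ≢h = ⊥-elim (≢h refl)
  ≢⇒opposite {zero}     {suc zero} _  = refl
  ≢⇒opposite {suc zero} {zero}     _  = refl
  ≢⇒opposite {suc zero} {suc zero} ≢h = ⊥-elim (≢h refl)

  -- A vertex misses itself and the opposite half of its third, so the count is
  -- `(6q - q - 1) + (6q + 1) + 6q = 17q`. Adding `q + 1` on both sides avoids subtraction.
  degree : ∀ i → ∃ λ ns → Unique ns × All (κ i) ns × 17 * q ≤ length ns + suc c + c
  degree i = select (κ? i) , Unique.filter⁺ (κ? i) (Unique.allFin⁺ c) , all-filter (κ? i) (allFin c) ,
    +-cancelˡ-≤ (suc q) _ _ (begin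
      suc q + 17 * q                             ≡⟨ solve 1 (λ q → con 1 :+ q :+ con 17 :* q :=
        con 3 :* (con 2 :* q) :+ (con 1 :+ con 3 :* (con 2 :* q) :+ con 3 :* (con 2 :* q))) refl q ⟩
      c + (suc c + c)                            ≤⟨ +-monoˡ-≤ (suc c + c) (length-select+ (κ? i) excluded rest) ⟩
      length ns + length excluded + (suc c + c)  ≡⟨ cong (λ x → length ns + suc x + (suc c + c)) (length-cell (third i) (opposite (half i))) ⟩
      length ns + suc q + (suc c + c)            ≡⟨ solve 3 (λ n q c → n :+ (con 1 :+ q) :+ (con 1 :+ c :+ c) :=
        con 1 :+ q :+ (n :+ (con 1 :+ c) :+ c)) refl (length ns) q c ⟩
      suc q + (length ns + suc c + c)            ∎)
    where
    open ≤-Reasoning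
    open +-*-Solver
    ns excluded : List (Fin c)
    ns = select (κ? i)
    excluded = i ∷ cell (third i) (opposite (half i))
    rest : ∀ j → ¬ κ i j → j ∈ excluded
    rest j ¬κ with i Fin.≟ j
    ... | yes i≡j = here (sym i≡j)
    ... | no i≢j with (third i Fin.≟ third j) ×-dec ¬? (half i Fin.≟ half j)
    ...   | yes (t , ≢h) = there (∈-cell (sym t) (≢⇒opposite ≢h))
    ...   | no ¬th       = ⊥-elim (¬κ (i≢j , ¬th))

  late : ℕ → List (Fin c)
  late r = select (λ i → r ≤? part i)

  -- `combine` lists the thirds one after another, so third `r` starts at index `2 * q * r`.
  length-late : ∀ r b → 2 * q * r + b ≡ c → length (late r) ≤ b
  length-late r b eq = select-interval (2 * q * r) b (λ i → r ≤? part i) λ {i} r≤ →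
    (begin
      2 * q * r                            ≤⟨ *-monoʳ-≤ (2 * q) r≤ ⟩
      2 * q * part i                       ≤⟨ m≤m+n _ _ ⟩
      2 * q * part i + toℕ (within i)      ≡⟨ toℕ-combine (third i) (within i) ⟨
      toℕ (combine (third i) (within i))   ≡⟨ cong toℕ (unsplit i) ⟩
      toℕ i                                ∎) ,
    ≤-trans (toℕ<n i) (≤-reflexive (sym eq))
    where open ≤-Reasoning

  few-late : length (late 0) + (length (late 1) + length (late 2)) < k + k
  few-late = begin-strict
    length (late 0) + (length (late 1) + length (late 2))
      ≤⟨ +-mono-≤ (length-late 0 c (cong (_+ c) (*-zeroʳ (2 * q))))
           (+-mono-≤ (length-late 1 (4 * q) (solve 1 (λ q → con 2 :* q :* con 1 :+ con 4 :* q := con 3 :* (con 2 :* q)) refl q))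
                     (length-late 2 (2 * q) (solve 1 (λ q → con 2 :* q :* con 2 :+ con 2 :* q := con 3 :* (con 2 :* q)) refl q))) ⟩
    c + (4 * q + 2 * q)
      ≡⟨ solve 1 (λ q → con 3 :* (con 2 :* q) :+ (con 4 :* q :+ con 2 :* q) := con 3 :* (con 2 :* q) :+ con 3 :* (con 2 :* q)) refl q ⟩
    c + c
      <⟨ +-mono-< c<k c<k ⟩
    k + k ∎
    where
    open ≤-Reasoning
    open +-*-Solver

  side : Bag c → Fin 2
  -- Any value serves: `core` lies in none of the sets to be halved.
  side core    = zero
  side (new i) = half i
  side (old i) = half i

  -- A third of the bag is cut into its two halves by everything else.
  bounded-halve : ∀ {P Th : Bag c → Set} → (∀ x → Dec (Th x)) →
    (∀ {x y} → P x → P y → Th x → Th y → BagAdj part κ x y → side x ≡ side y) →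
    (X : List (Bag c)) → length X ≤ k → (∀ {x} → P x → ¬ Th x → x ∈ X) →
    (∀ h → Bounded k k (BagAdj part κ) (λ x → P x × (Th x → side x ≡ h))) →
    Bounded k k (BagAdj part κ) P
  bounded-halve {P} {Th} Th? same X ≤k others b =
    bounded-split k k (BagAdj part κ) (on? zero) (on? (suc zero)) (λ {x} _ → cover x) sides X ≤k shared (b zero) (b (suc zero))
    where
    -- An implication, so that everything outside `Th` counts on both sides and forms the separator.
    On : Fin 2 → Bag c → Set
    On h x = Th x → side x ≡ h

    on? : ∀ h x → Dec (On h x)
    on? h x = Th? x →-dec (side x Fin.≟ h)

    either : ∀ h {A : Fin 2 → Set} → A h → A zero ⊎ A (suc zero)
    either zero       = inj₁
    either (suc zero) = inj₂

    cover : ∀ x → On zero x ⊎ On (suc zero) x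
    cover x = either (side x) {λ h → On h x} (λ _ → refl)

    sides : ∀ {x y} → P x → P y → BagAdj part κ x y → (On zero x × On zero y) ⊎ (On (suc zero) x × On (suc zero) y)
    sides {x} {y} Px Py a with Th? x
    ... | yes t = either (side x) {λ h → On h x × On h y} ((λ _ → refl) , λ t′ → sym (same Px Py t t′ a))
    ... | no ¬t = either (side y) {λ h → On h x × On h y} ((λ t → ⊥-elim (¬t t)) , λ _ → refl)

    shared : ∀ {x} → P x → On zero x → On (suc zero) x → x ∈ X
    shared {x} Px on₀ on₁ = others Px λ t → distinct (trans (sym (on₀ t)) (on₁ t))
      where
      distinct : Fin.zero {1} ≢ suc zero
      distinct ()

  New : Fin 3 → Bag c → Set
  New t (new i) = third i ≡ t
  New t _       = ⊥

  Old : Bag c → Set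
  Old (old _) = ⊤
  Old _       = ⊥

  New? : ∀ t x → Dec (New t x)
  New? t core    = no λ ()
  New? t (new i) = third i Fin.≟ t
  New? t (old _) = no λ ()

  Old? : ∀ x → Dec (Old x)
  Old? core    = no λ ()
  Old? (new _) = no λ ()
  Old? (old _) = yes tt

  module _ (s : Fin 3) where

    In : Bag c → Set
    In = InPart part (toℕ s)

    old-third : ∀ {i} → In (old i) → third i ≡ s
    old-third = toℕ-injective

    -- The third t of the new clique is traded for the equally large third s of the old vertices.
    trade : Fin 3 → Fin c → Bag c
    trade t i with third i Fin.≟ t
    ... | yes _ = old (combine s (within i))
    ... | no _  = new i

    -- The separator for the new third `t`: `core`, the other two new thirds and the old third `s`,
    -- again `c + 1` vertices.
    rest-of : Fin 3 → List (Bag c)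
    rest-of t = core ∷ map (trade t) (allFin c)

    length-rest-of : ∀ t → length (rest-of t) ≤ k
    length-rest-of t = ≤-trans (s≤s (≤-reflexive (trans (length-map (trade t) (allFin c)) (length-allFin c)))) c<k

    ∈-rest-of : ∀ t {x} → In x → ¬ New t x → x ∈ rest-of t
    ∈-rest-of t {core}  _ _ = here refl
    ∈-rest-of t {new i} _ ≢t = there (subst (_∈ map (trade t) (allFin c)) trade-new (∈-map⁺ (trade t) (∈-allFin i)))
      where
      trade-new : trade t i ≡ new i
      trade-new with third i Fin.≟ t
      ... | yes e = ⊥-elim (≢t e)
      ... | no _  = refl
    ∈-rest-of t {old i} in-s _ = there (subst (_∈ map (trade t) (allFin c)) trade-old
      (∈-map⁺ (trade t) (∈-allFin (combine t (within i)))))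
      where
      trade-old : trade t (combine t (within i)) ≡ old i
      trade-old with third (combine t (within i)) Fin.≟ t
      ... | no ≢t = ⊥-elim (≢t (third-combine t (within i)))
      ... | yes _ = cong old (trans (cong₂ combine (sym (old-third {i} in-s)) (within-combine t (within i))) (unsplit i))

    new-same : ∀ t {x y} → New t x → New t y → BagAdj part κ x y → side x ≡ side y
    new-same t {new i} {new j} refl e κij = κ-half κij (sym e)

    old-same : ∀ {x y} → Old x → Old y → BagAdj part κ x y → side x ≡ side y
    old-same {old i} {old j} _ _ (e , κij) = κ-half κij (toℕ-injective e)

    halve-new : ∀ t {P : Bag c → Set} → (∀ {x} → P x → In x) →
      (∀ h → Bounded k k (BagAdj part κ) (λ x → P x × (New t x → side x ≡ h))) → Bounded k k (BagAdj part κ) P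
    halve-new t P⊆In = bounded-halve (New? t) (λ {x} {y} _ _ → new-same t {x} {y})
      (rest-of t) (length-rest-of t) (∈-rest-of t ∘ P⊆In)

    halve-old : ∀ {P : Bag c → Set} →
      (∀ h → Bounded k k (BagAdj part κ) (λ x → P x × (Old x → side x ≡ h))) → Bounded k k (BagAdj part κ) P
    halve-old = bounded-halve Old? (λ {x} {y} _ _ → old-same {x} {y})
      middle (≤-trans (≤-reflexive length-middle) c<k) (λ {x} _ → not-old x)
      where
      not-old : ∀ x → ¬ Old x → x ∈ middle
      not-old core    _  = here refl
      not-old (new i) _  = there (∈-map⁺ new (∈-allFin i))
      not-old (old i) ¬o = ⊥-elim (¬o tt)

    -- Halving the old third and the three new ones leaves `core` and four cells of size `q`. These
    -- `4q + 1` vertices are at most `6q + 1`, hence at most `k`.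
    bag : Bounded k k (BagAdj part κ) In
    bag = halve-old λ h → halve-new zero proj₁ λ h₀ → halve-new (suc zero) (proj₁ ∘ proj₁) λ h₁ →
      halve-new (suc (suc zero)) (proj₁ ∘ proj₁ ∘ proj₁) λ h₂ →
      bounded-list k k _ (halves h h₀ h₁ h₂) (size h h₀ h₁ h₂)
        (λ { {x} ((((i , o) , n₀) , n₁) , n₂) → cover x i o n₀ n₁ n₂ })
      where
      halves : (h h₀ h₁ h₂ : Fin 2) → List (Bag c)
      halves h h₀ h₁ h₂ = core ∷ map old (cell s h) ++
        map new (cell zero h₀) ++ map new (cell (suc zero) h₁) ++ map new (cell (suc (suc zero)) h₂)

      size : ∀ h h₀ h₁ h₂ → length (halves h h₀ h₁ h₂) ≤ k
      size h h₀ h₁ h₂ = begin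
        length (halves h h₀ h₁ h₂)  ≡⟨ cong suc (append old s h (append new zero h₀ (append new (suc zero) h₁ (len new (suc (suc zero)) h₂)))) ⟩
        suc (q + (q + (q + q)))     ≤⟨ s≤s (m≤m+n _ (2 * q)) ⟩
        suc (q + (q + (q + q)) + 2 * q) ≡⟨ cong suc (solve 1 (λ q → q :+ (q :+ (q :+ q)) :+ con 2 :* q := con 3 :* (con 2 :* q)) refl q) ⟩
        suc c                       ≤⟨ c<k ⟩
        k                           ∎
        where
        open ≤-Reasoning
        open +-*-Solver
        len : ∀ (f : Fin c → Bag c) t h → length (map f (cell t h)) ≡ q
        len f t h = trans (length-map f (cell t h)) (length-cell t h)
        append : ∀ (f : Fin c → Bag c) t h {xs n} → length xs ≡ n → length (map f (cell t h) ++ xs) ≡ q + n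
        append f t h e = trans (length-++ (map f (cell t h))) (cong₂ _+_ (len f t h) e)

      cover : ∀ x {h h₀ h₁ h₂} → In x → (Old x → side x ≡ h) → (New zero x → side x ≡ h₀) →
        (New (suc zero) x → side x ≡ h₁) → (New (suc (suc zero)) x → side x ≡ h₂) → x ∈ halves h h₀ h₁ h₂
      cover core _ _ _ _ _ = here refl
      cover (old i) in-s o _ _ _ = there (∈-++⁺ˡ (∈-map⁺ old (∈-cell (old-third {i} in-s) (o tt))))
      cover (new i) {h} {h₀} {h₁} {h₂} _ _ n₀ n₁ n₂ = there (∈-++⁺ʳ (map old (cell s h)) (by-third (third i) refl))
        where
        by-third : ∀ t → third i ≡ t →
          new i ∈ map new (cell zero h₀) ++ map new (cell (suc zero) h₁) ++ map new (cell (suc (suc zero)) h₂)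
        by-third zero e = ∈-++⁺ˡ (∈-map⁺ new (∈-cell e (n₀ e)))
        by-third (suc zero) e = ∈-++⁺ʳ (map new (cell zero h₀)) (∈-++⁺ˡ (∈-map⁺ new (∈-cell e (n₁ e))))
        by-third (suc (suc zero)) e =
          ∈-++⁺ʳ (map new (cell zero h₀)) (∈-++⁺ʳ (map new (cell (suc zero) h₁)) (∈-map⁺ new (∈-cell e (n₂ e))))

  pattern₆ : Pattern k c (17 * q) k
  pattern₆ = record
    { c<k = c<k ; 1≤β = ≤-trans (s≤s z≤n) c<k ; part = part ; part≤2 = part≤2
    ; κ = κ ; κ? = κ?
    ; κ-sym = λ { (i≢j , ¬th) → i≢j ∘ sym , λ { (t , ≢h) → ¬th (sym t , ≢h ∘ sym) } }
    ; κ-irrefl = λ { (i≢i , _) → i≢i refl }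
    ; δ≤3c = ≤-trans (m≤m+n (17 * q) q) (≤-reflexive (solve 1 (λ q → con 17 :* q :+ q :=
        con 3 :* (con 2 :* q) :+ (con 3 :* (con 2 :* q) :+ con 3 :* (con 2 :* q))) refl q))
    ; κ-degree = degree
    ; late = late ; late⁺ = λ {r} {i} r≤ → ∈-filter⁺ (λ i → r ≤? part i) (∈-allFin i) r≤
    ; late⁻ = λ {r} i∈ → proj₂ (∈-filter⁻ (λ i → r ≤? part i) {xs = allFin c} i∈)
    ; few-late = few-late
    ; bag = bounded-parts c<k part part≤2 κ bag
    }
    where open +-*-Solver

-- Choice of parameters and conclusion.

record Split₃ (c : ℕ) : Set where
  field
    p₀ p₁ p₂ : ℕ
    p₂≤p₁ : p₂ ≤ p₁
    p₁≤p₀ : p₁ ≤ p₀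
    p₀≤   : p₀ ≤ suc p₂
    sum   : p₀ + p₁ + p₂ ≡ c

-- Adding one to the smallest part makes it a largest one, so the parts rotate and stay within one
-- of each other.
split₃ : ∀ c → Split₃ c
split₃ zero = record { p₀ = 0 ; p₁ = 0 ; p₂ = 0 ; p₂≤p₁ = z≤n ; p₁≤p₀ = z≤n ; p₀≤ = z≤n ; sum = refl }
split₃ (suc c) = record
  { p₀ = suc p₂ ; p₁ = p₀ ; p₂ = p₁ ; p₂≤p₁ = p₁≤p₀ ; p₁≤p₀ = p₀≤ ; p₀≤ = s≤s p₂≤p₁
  ; sum = cong suc (trans (+-assoc p₂ p₀ p₁) (trans (+-comm p₂ (p₀ + p₁)) sum)) }
  where open Split₃ (split₃ c)

LargeMinDegree : ℕ → Set
LargeMinDegree k = Σ Graph (λ G → MinDegreeEq G (3 * k ∸ 3) ×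
  ((H : Subgraph G) → KConn k H → ∣ S H ∣ ≤ ceil4k/3 k))

large-min-degree : ∀ c → LargeMinDegree (suc c)
large-min-degree c = subst (λ m → LargeMinDegree (suc m)) sum (exactly (realise (Tower.piece thirds) (Tower.length-bs thirds)))
  where
  open Split₃ (split₃ c)
  open +-*-Solver

  m : ℕ
  m = p₀ + p₁ + p₂

  fits : suc m + p₀ ≤ ceil4k/3 (suc m)
  fits = begin
    suc m + p₀              ≡⟨ m*n/n≡m (suc m + p₀) 3 ⟨
    (suc m + p₀) * 3 / 3    ≤⟨ /-monoˡ-≤ 3 triple ⟩
    (4 * suc m + 2) / 3     ∎
    where
    open ≤-Reasoning
    -- Balance gives `3 * p₀` at most `m + 2`, so the left side is at most `4 * m + 5`, one less
    -- than the right side.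
    triple : (suc m + p₀) * 3 ≤ 4 * suc m + 2
    triple = begin
      (suc m + p₀) * 3                                  ≡⟨ solve 2 (λ m p → (con 1 :+ m :+ p) :* con 3 := con 3 :+ con 3 :* m :+ (p :+ (p :+ p))) refl m p₀ ⟩
      3 + 3 * m + (p₀ + (p₀ + p₀))                      ≤⟨ +-monoʳ-≤ (3 + 3 * m) (+-monoʳ-≤ p₀ (+-mono-≤ (≤-trans p₀≤ (s≤s p₂≤p₁)) p₀≤)) ⟩
      3 + 3 * m + (p₀ + (suc p₁ + suc p₂))              ≤⟨ n≤1+n _ ⟩
      1 + (3 + 3 * m + (p₀ + (suc p₁ + suc p₂)))        ≡⟨ solve 3 (λ a b c → con 1 :+ (con 3 :+ con 3 :* (a :+ b :+ c) :+ (a :+ ((con 1 :+ b) :+ (con 1 :+ c))))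
                                                             := con 4 :* (con 1 :+ (a :+ b :+ c)) :+ con 2) refl p₀ p₁ p₂ ⟩
      4 * suc m + 2                                     ∎

  3k∸3 : 3 * suc m ∸ 3 ≡ m + (m + m)
  3k∸3 = trans (cong (_∸ 3) (solve 1 (λ m → con 3 :* (con 1 :+ m) := con 3 :+ (m :+ (m :+ m))) refl m)) (m+n∸m≡n 3 (m + (m + m)))

  thirds : Pattern (suc m) m (m + (m + m)) (ceil4k/3 (suc m))
  thirds = Thirds.pattern₃ p₀ p₁ p₂ (ceil4k/3 (suc m)) p₂≤p₁ p₁≤p₀ fits

  exactly : (∃ λ G → (∀ v → m + (m + m) ≤ deg G v) × (∃ λ v → deg G v ≤ m + (m + m)) ×
    (∀ (H : Subgraph G) → KConn (suc m) H → ∣ S H ∣ ≤ ceil4k/3 (suc m))) → LargeMinDegree (suc m)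
  exactly (G , deg≥ , (v , deg≤) , small) =
    G , subst (MinDegreeEq G) (sym 3k∸3) (deg≥ , v , ≤-antisym deg≤ (deg≥ v)) , small

NoHighlyConnected : ℕ → Set
NoHighlyConnected k = Σ Graph (λ G → (1 ≤ n G) ×
  ((v : _) → 17 * k ≤ 6 * deg G v + 6 * 17) × ((H : Subgraph G) → ¬ KConn k H))

no-highly-connected : ∀ l → NoHighlyConnected (suc l)
no-highly-connected l = weaken (realise (Tower.piece halved) (Tower.length-bs halved))
  where
  open +-*-Solver
  open ≤-Reasoning

  q k : ℕ
  -- The largest `q` with `6q < k`; hence `k` is at most `6q + 6`.
  q = l / 6
  k = suc l

  6q≤ : 3 * (2 * q) ≤ l
  6q≤ = ≤-trans (≤-reflexive (solve 1 (λ q → con 3 :* (con 2 :* q) := q :* con 6) refl q)) (m/n*n≤m l 6)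

  halved : Pattern k (3 * (2 * q)) (17 * q) k
  halved = HalvedThirds.pattern₆ q k (s≤s 6q≤)

  k≤ : k ≤ 6 + q * 6
  k≤ = ≤-trans (s≤s (≤-reflexive (m≡m%n+[m/n]*n l 6))) (+-monoˡ-≤ (q * 6) (m%n<n l 6))

  enough : ∀ {d} → 17 * q ≤ d → 17 * k ≤ 6 * d + 6 * 17
  enough {d} 17q≤ = begin
    17 * k                   ≤⟨ *-monoʳ-≤ 17 k≤ ⟩
    17 * (6 + q * 6)         ≡⟨ solve 1 (λ q → con 17 :* (con 6 :+ q :* con 6) := con 6 :* (con 17 :* q) :+ con 6 :* con 17) refl q ⟩
    6 * (17 * q) + 6 * 17    ≤⟨ +-monoˡ-≤ (6 * 17) (*-monoʳ-≤ 6 17q≤) ⟩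
    6 * d + 6 * 17           ∎

  weaken : (∃ λ G → (∀ v → 17 * q ≤ deg G v) × (∃ λ v → deg G v ≤ 3 * (2 * q) + (3 * (2 * q) + 3 * (2 * q))) ×
    (∀ (H : Subgraph G) → KConn k H → ∣ S H ∣ ≤ k)) → NoHighlyConnected k
  weaken (G , deg≥ , (v , _) , small) =
    G , ≤-trans (s≤s z≤n) (toℕ<n v) , (λ v → enough (deg≥ v)) ,
    -- Being `(k+1)`-connected demands more than `k + 1` vertices, but at most `k` are possible.
    λ H conn → <⇒≱ (proj₁ conn) (≤-trans (small H conn) (n≤1+n k))

theorem2 : ((k : ℕ) → 1 ≤ k →
    Σ Graph (λ G → MinDegreeEq G (3 * k ∸ 3) ×
    ((H : Subgraph G) → KConn k H → ∣ S H ∣ ≤ ceil4k/3 k)))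
    ×
    Σ ℕ (λ c → (k : ℕ) → 1 ≤ k →
    Σ Graph (λ G → (1 ≤ n G) ×
    ((v : _) → 17 * k ≤ 6 * deg G v + 6 * c) ×
    ((H : Subgraph G) → ¬ KConn k H)))
-- `3 - 1/6` is `17/6`, and rounding `k` down to `6q` loses at most 6, which costs at most 17 in the
-- degree.
theorem2 = (λ { (suc c) _ → large-min-degree c }) , 17 , λ { (suc l) _ → no-highly-connected l }
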